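{- Let $n\ge1$, $r\ge 1$ and $\pi_1,\dots,\pi_r\in\mathfrak{B}_n$. An element $\sigma\in\mathfrak{B}_n$ is a maximal element below $\pi_1,\dots,\pi_r$ if and only if the four inequalities $$\ell_1(\sigma)\ge\max_{1\le j\le r}\ell_1(\pi_j),\quad \ell_2(\sigma)\le\min_{1\le j\le r}\ell_2(\pi_j),\quad \ell_3(\sigma)\le\min_{1\le j\le r}\ell_3(\pi_j),\quad \ell_4(\sigma)\ge\max_{1\le j\le r}\ell_4(\pi_j)$$ all hold, with equality in both the inequalities for $\ell_2$ and $\ell_3$, or with equality in both the inequalities for $\ell_1$ and $\ell_4$.
   Context: $\mathfrak{S}_n$ is the set of permutations of $[n]=\{1,\dots,n\}$, in one-line notation. A reduction of $\omega\in\mathfrak{S}_n$ interchanges $\omega(i)$ and $\omega(j)$ for some $i<j$ with $\omega(i)>\omega(j)$. Bruhat order: $\pi\le\sigma$ if $\pi$ is obtained from $\sigma$ by a (possibly empty) sequence of reductions. $\mathfrak{B}_n\subseteq\mathfrak{S}_n$ is the set of bigrassmannian permutations (both $\omega$ and $\omega^{ -1}$ have exactly one descent), with the order inherited from Bruhat order; equivalently $\omega=1\cdots a\,(b+1)\cdots c\,(a+1)\cdots b\,(c+1)\cdots n$ for a unique triple $0\le a<b<c\le n$. The length vector of such an element is $(\ell_1,\ell_2,\ell_3,\ell_4)=(a+1,b-a,c-b,n+1-c)$. $\sigma\in\mathfrak{B}_n$ is a maximal element below $\pi_1,\dots,\pi_r$ if $\sigma\le\pi_i$ for each $i$, and whenever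 $\tau\in\mathfrak{B}_n$ satisfies $\tau\le\pi_i$ for all $i$ and $\tau\ge\sigma$, then $\tau=\sigma$. -}

module Defs where

open import Data.Fin.Base as Fin using (Fin; toℕ; fromℕ<)
open import Data.Fin.Permutation
  using (Permutation′; _⟨$⟩ʳ_; _⟨$⟩ˡ_; flip; transpose; _∘ₚ_; inverseˡ; inverseʳ)
  renaming (_≈_ to _≈ₚ_)
import Data.Fin.Properties as Fin
open import Data.Nat.Base
open import Data.Nat.Induction using (<-rec)
open import Data.Nat.Properties
open import Data.Product using (∃; ∃₂; ∃!; _×_; _,_; proj₁; proj₂)
open import Data.Sum.Base using (_⊎_; inj₁; inj₂)
open import Data.Vec.Base using (foldr₁; tabulate)
open import Function.Base using (_∘_)
open import Relation.Binary.Construct.Closure.ReflexiveTransitive using (Star)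
open import Relation.Binary.Definitions using (tri<; tri≈; tri>)
open import Relation.Binary.PropositionalEquality
open import Relation.Nullary using (¬_; yes; no; contradiction)

private
  variable
    n r : ℕ

-- Positions and values are elements of Fin n, so they are 0-based: i : Fin n
-- stands for toℕ i + 1 in [n] = {1,…,n}.  Since permutations carry proof
-- components, they are compared by pointwise equality _≈ₚ_.

------------------------------------------------------------------------
-- Bruhat order

-- transpose i j ∘ₚ ω is "first transpose i j, then ω", so it is ω with the
-- entries at positions i and j interchanged.
Reduction : Permutation′ n → Permutation′ n → Set
Reduction ω ω′ = ∃₂ λ i j →
  i Fin.< j × (ω ⟨$⟩ʳ j) Fin.< (ω ⟨$⟩ʳ i) × ω′ ≈ₚ (transpose i j ∘ₚ ω)

infix 4 _≤ᴮ_

_≤ᴮ_ : Permutation′ n → Permutation′ n → Set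
π ≤ᴮ σ = ∃ λ ρ → Star Reduction σ ρ × ρ ≈ₚ π

------------------------------------------------------------------------
-- Bigrassmannian permutations

IsDescent : Permutation′ n → Fin n → Set
IsDescent ω i = ∃ λ j → toℕ j ≡ suc (toℕ i) × (ω ⟨$⟩ʳ j) Fin.< (ω ⟨$⟩ʳ i)

HasExactlyOneDescent : Permutation′ n → Set
HasExactlyOneDescent ω = ∃! _≡_ (IsDescent ω)

record 𝔅 (n : ℕ) : Set where
  field
    perm               : Permutation′ n
    one-descent        : HasExactlyOneDescent perm
    one-descent-of-inv : HasExactlyOneDescent (flip perm)

open 𝔅 public

-- ω = 1⋯a (b+1)⋯c (a+1)⋯b (c+1)⋯n: in 0-based terms the successive blocks of
-- the one-line notation are [0,a), [b,c), [a,b), [c,n), and they start at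
-- positions 0, a, a+(c-b), c.
record BlockForm {n : ℕ} (ω : Permutation′ n) : Set where
  field
    a b c  : ℕ
    a<b    : a < b
    b<c    : b < c
    c≤n    : c ≤ n
    block₁ : ∀ i → toℕ i < a → toℕ (ω ⟨$⟩ʳ i) ≡ toℕ i
    block₂ : ∀ i k → k < c ∸ b → toℕ i ≡ a + k → toℕ (ω ⟨$⟩ʳ i) ≡ b + k
    block₃ : ∀ i k → k < b ∸ a → toℕ i ≡ a + (c ∸ b) + k →
             toℕ (ω ⟨$⟩ʳ i) ≡ a + k
    block₄ : ∀ i → c ≤ toℕ i → toℕ (ω ⟨$⟩ʳ i) ≡ toℕ i

------------------------------------------------------------------------
-- Every bigrassmannian permutation has a block form

private

  -- The argument is carried out for a bijection F of ℕ (with inverse G) that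
  -- is the identity from n on; d and e are the descents of F and G.
  module Blocks
    (F G : ℕ → ℕ) (n d e : ℕ)
    (GF : ∀ i → G (F i) ≡ i) (FG : ∀ i → F (G i) ≡ i)
    (F-id : ∀ i → n ≤ i → F i ≡ i)
    (d<n : suc d ≤ n) (e<n : suc e ≤ n)
    (F-up : ∀ i → i ≢ d → F i < F (suc i))
    (G-up : ∀ i → i ≢ e → G i < G (suc i))
    (F-down : F (suc d) < F d)
    where

    s t : ℕ
    s = suc d
    t = suc e

    F-inj : ∀ {i j} → F i ≡ F j → i ≡ j
    F-inj {i} {j} eq = trans (sym (GF i)) (trans (cong G eq) (GF j))

    -- A function increasing at every step but x increases on both sides of x.
    module Mono (H : ℕ → ℕ) (x : ℕ) (up : ∀ i → i ≢ x → H i < H (suc i)) where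

      below : ∀ i j → i < j → j ≤ x → H i < H j
      below i (suc j) (s≤s i≤j) j<x with m≤n⇒m<n∨m≡n i≤j
      ... | inj₁ i<j  = <-trans (below i j i<j (<⇒≤ j<x)) (up j (<⇒≢ j<x))
      ... | inj₂ refl = up j (<⇒≢ j<x)

      above : ∀ i j → i < j → x < i → H i < H j
      above i (suc j) (s≤s i≤j) x<i with m≤n⇒m<n∨m≡n i≤j
      ... | inj₁ i<j  = <-trans (above i j i<j x<i)
                                (up j (>⇒≢ (<-trans x<i i<j)))
      ... | inj₂ refl = up j (>⇒≢ x<i)

    module F↑ = Mono F d F-up
    module G↑ = Mono G e G-up

    -- On [lo,hi) where F increases, the positions with value < t come first.
    cut : ∀ lo hi → lo ≤ hi → (∀ i j → lo ≤ i → i < j → j < hi → F i < F j) →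
          ∃ λ m → lo ≤ m × m ≤ hi ×
                  (∀ i → lo ≤ i → i < m → F i < t) ×
                  (∀ i → m ≤ i → i < hi → t ≤ F i)
    cut lo hi lo≤hi mono with m≤n⇒m<n∨m≡n lo≤hi
    ... | inj₂ refl = lo , ≤-refl , ≤-refl
                    , (λ i p q → contradiction (<-≤-trans q p) (<-irrefl refl))
                    , (λ i p q → contradiction (<-≤-trans q p) (<-irrefl refl))
    cut lo (suc h) lo≤hi mono | inj₁ (s≤s lo≤h) with F h <? t
    ... | yes Fh<t = suc h , lo≤hi , ≤-refl , low
                   , (λ i p q → contradiction (<-≤-trans q p) (<-irrefl refl))
      where
      low : ∀ i → lo ≤ i → i < suc h → F i < t
      low i lo≤i (s≤s i≤h) with m≤n⇒m<n∨m≡n i≤h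
      ... | inj₁ i<h  = <-trans (mono i h lo≤i i<h ≤-refl) Fh<t
      ... | inj₂ refl = Fh<t
    ... | no Fh≮t
      with cut lo h lo≤h (λ i j p q r → mono i j p q (m<n⇒m<1+n r))
    ... | m , lo≤m , m≤h , low , high = m , lo≤m , m≤n⇒m≤1+n m≤h , low , high′
      where
      high′ : ∀ i → m ≤ i → i < suc h → t ≤ F i
      high′ i m≤i (s≤s i≤h) with m≤n⇒m<n∨m≡n i≤h
      ... | inj₁ i<h  = high i m≤i i<h
      ... | inj₂ refl = ≮⇒≥ Fh≮t

    cut₁ = cut 0 s z≤n (λ i j _ i<j j<s → F↑.below i j i<j (s≤s⁻¹ j<s))
    cut₂ = cut s n d<n (λ i j s≤i i<j _ → F↑.above i j i<j s≤i)

    a c p q : ℕ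
    a = proj₁ cut₁
    c = proj₁ cut₂
    p = s ∸ a
    q = c ∸ s

    a≤s : a ≤ s
    a≤s = proj₁ (proj₂ (proj₂ cut₁))

    s≤c : s ≤ c
    s≤c = proj₁ (proj₂ cut₂)

    c≤n : c ≤ n
    c≤n = proj₁ (proj₂ (proj₂ cut₂))

    a+p : a + p ≡ s
    a+p = m+[n∸m]≡n a≤s

    s+q : s + q ≡ c
    s+q = m+[n∸m]≡n s≤c

    low₁ : ∀ i → i < a → F i < t
    low₁ i = proj₁ (proj₂ (proj₂ (proj₂ cut₁))) i z≤n

    high₁ : ∀ i → a ≤ i → i < s → t ≤ F i
    high₁ = proj₂ (proj₂ (proj₂ (proj₂ cut₁)))

    low₂ : ∀ i → s ≤ i → i < c → F i < t
    low₂ = proj₁ (proj₂ (proj₂ (proj₂ cut₂)))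

    high₂ : ∀ i → c ≤ i → t ≤ F i
    high₂ i c≤i with i <? n
    ... | yes i<n = proj₂ (proj₂ (proj₂ (proj₂ cut₂))) i c≤i i<n
    ... | no  i≮n = ≤-trans e<n
                      (≤-trans (≮⇒≥ i≮n) (≤-reflexive (sym (F-id i (≮⇒≥ i≮n)))))

    low-position : ∀ i → F i < t → i < a ⊎ s ≤ i × i < c
    low-position i Fi<t with i <? a
    ... | yes i<a = inj₁ i<a
    ... | no  i≮a with i <? s
    ... | yes i<s = contradiction (high₁ i (≮⇒≥ i≮a) i<s) (<⇒≱ Fi<t)
    ... | no  i≮s with i <? c
    ... | yes i<c = inj₂ (≮⇒≥ i≮s , i<c)
    ... | no  i≮c = contradiction (high₂ i (≮⇒≥ i≮c)) (<⇒≱ Fi<t)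

    high-position : ∀ i → t ≤ F i → a ≤ i × i < s ⊎ c ≤ i
    high-position i t≤Fi with i <? a
    ... | yes i<a = contradiction t≤Fi (<⇒≱ (low₁ i i<a))
    ... | no  i≮a with i <? s
    ... | yes i<s = inj₁ (≮⇒≥ i≮a , i<s)
    ... | no  i≮s with i <? c
    ... | yes i<c = contradiction t≤Fi (<⇒≱ (low₂ i (≮⇒≥ i≮s) i<c))
    ... | no  i≮c = inj₂ (≮⇒≥ i≮c)

    low-step : ∀ i v → F i < t → ¬ F i < v →
               (∀ j → j < i → v < t → F j ≢ v) → F i ≡ v
    low-step i v Fi<t Fi≮v v-new with <-cmp (F i) v
    ... | tri< Fi<v _ _ = contradiction Fi<v Fi≮v
    ... | tri≈ _ eq _   = eq
    ... | tri> _ _ v<Fi = contradiction (FG v) (v-new (G v) Gv<i (<-trans v<Fi Fi<t))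
      where
      Gv<i : G v < i
      Gv<i = subst (G v <_) (GF i) (G↑.below v (F i) v<Fi (s≤s⁻¹ Fi<t))

    high-step : ∀ i v → t ≤ v → ¬ F i < v → (∀ j → j < i → F j ≢ v) → F i ≡ v
    high-step i v t≤v Fi≮v v-new with <-cmp (F i) v
    ... | tri< Fi<v _ _ = contradiction Fi<v Fi≮v
    ... | tri≈ _ eq _   = eq
    ... | tri> _ _ v<Fi = contradiction (FG v) (v-new (G v) Gv<i)
      where
      Gv<i : G v < i
      Gv<i = subst (G v <_) (GF i) (G↑.above v (F i) v<Fi t≤v)

    split : ∀ {m j} → m ≤ j → ∃ λ k → j ≡ m + k
    split {m} {j} m≤j = j ∸ m , sym (m+[n∸m]≡n m≤j)

    F₁ : ∀ i → i < a → F i ≡ i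
    F₁ = <-rec (λ i → i < a → F i ≡ i) λ i ih i<a →
      low-step i i (low₁ i i<a)
        (λ Fi<i → <⇒≢ Fi<i (F-inj (ih Fi<i (<-trans Fi<i i<a))))
        (λ j j<i _ Fj≡i → <⇒≢ j<i (trans (sym (ih j<i (<-trans j<i i<a))) Fj≡i))

    F₃ : ∀ k → s + k < c → F (s + k) ≡ a + k
    F₃ = <-rec (λ k → s + k < c → F (s + k) ≡ a + k) step
      where
      step : ∀ k → (∀ {l} → l < k → s + l < c → F (s + l) ≡ a + l) →
             s + k < c → F (s + k) ≡ a + k
      step k ih s+k<c =
        low-step (s + k) (a + k) (low₂ (s + k) (m≤m+n s k) s+k<c) not-below new
        where
        ih′ : ∀ l → l < k → F (s + l) ≡ a + l
        ih′ l l<k = ih l<k (<-trans (+-monoʳ-< s l<k) s+k<c)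

        not-below : ¬ F (s + k) < a + k
        not-below lt with F (s + k) <? a
        ... | yes v<a = <⇒≢ (<-≤-trans v<a (≤-trans a≤s (m≤m+n s k)))
                            (F-inj (F₁ _ v<a))
        ... | no  v≮a with split (≮⇒≥ v≮a)
        ... | l , eq = <⇒≢ l<k (+-cancelˡ-≡ s l k (F-inj (trans (ih′ l l<k) (sym eq))))
          where
          l<k : l < k
          l<k = +-cancelˡ-< a l k (subst (_< a + k) eq lt)

        new : ∀ j → j < s + k → a + k < t → F j ≢ a + k
        new j j<s+k v<t eq with low-position j (subst (_< t) (sym eq) v<t)
        ... | inj₁ j<a = <⇒≢ (<-≤-trans j<a (m≤m+n a k)) (trans (sym (F₁ j j<a)) eq)
        ... | inj₂ (s≤j , _) with split s≤j
        ... | l , refl = <⇒≢ l<k (+-cancelˡ-≡ a l k (trans (sym (ih′ l l<k)) eq))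
          where
          l<k : l < k
          l<k = +-cancelˡ-< s l k j<s+k

    size : t ≡ a + q
    size = ≤-antisym (≮⇒≥ not-above) a+q≤t
      where
      not-above : ¬ a + q < t
      not-above lt with low-position (G (a + q)) (subst (_< t) (sym (FG (a + q))) lt)
      ... | inj₁ j<a = <⇒≱ j<a
                         (≤-trans (m≤m+n a q)
                           (≤-reflexive (trans (sym (FG (a + q))) (F₁ _ j<a))))
      ... | inj₂ (s≤j , j<c) with split s≤j
      ... | l , eq = <⇒≢ l<q (+-cancelˡ-≡ a l q
                       (trans (sym (F₃ l s+l<c)) (trans (cong F (sym eq)) (FG (a + q)))))
        where
        s+l<c : s + l < c
        s+l<c = subst (_< c) eq j<c
        l<q : l < q
        l<q = +-cancelˡ-< s l q (subst (s + l <_) (sym s+q) s+l<c)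

      all-below : ∀ m → (∀ i → i < m → i < t) → m ≤ t
      all-below zero    h = z≤n
      all-below (suc m) h = h m ≤-refl

      a+q≤t : a + q ≤ t
      a+q≤t = all-below (a + q) λ v v<a+q → value-low v v<a+q
        where
        value-low : ∀ v → v < a + q → v < t
        value-low v v<a+q with v <? a
        ... | yes v<a = subst (_< t) (F₁ v v<a) (low₁ v v<a)
        ... | no  v≮a with split (≮⇒≥ v≮a)
        ... | l , refl = subst (_< t) (F₃ l s+l<c) (low₂ (s + l) (m≤m+n s l) s+l<c)
          where
          s+l<c : s + l < c
          s+l<c = subst (s + l <_) s+q (+-monoʳ-< s (+-cancelˡ-< a l q v<a+q))

    F₂ : ∀ k → a + k < s → F (a + k) ≡ t + k
    F₂ = <-rec (λ k → a + k < s → F (a + k) ≡ t + k) step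
      where
      step : ∀ k → (∀ {l} → l < k → a + l < s → F (a + l) ≡ t + l) →
             a + k < s → F (a + k) ≡ t + k
      step k ih a+k<s = high-step (a + k) (t + k) (m≤m+n t k) not-below new
        where
        ih′ : ∀ l → l < k → F (a + l) ≡ t + l
        ih′ l l<k = ih l<k (<-trans (+-monoʳ-< a l<k) a+k<s)

        not-below : ¬ F (a + k) < t + k
        not-below lt with split (high₁ (a + k) (m≤m+n a k) a+k<s)
        ... | l , eq = <⇒≢ l<k (+-cancelˡ-≡ a l k (F-inj (trans (ih′ l l<k) (sym eq))))
          where
          l<k : l < k
          l<k = +-cancelˡ-< t l k (subst (_< t + k) eq lt)

        new : ∀ j → j < a + k → F j ≢ t + k
        new j j<a+k eq with high-position j (subst (t ≤_) (sym eq) (m≤m+n t k))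
        ... | inj₂ c≤j = <⇒≱ (<-trans j<a+k a+k<s) (≤-trans s≤c c≤j)
        ... | inj₁ (a≤j , _) with split a≤j
        ... | l , refl = <⇒≢ l<k (+-cancelˡ-≡ t l k (trans (sym (ih′ l l<k)) eq))
          where
          l<k : l < k
          l<k = +-cancelˡ-< a l k j<a+k

    c≡t+p : c ≡ t + p
    c≡t+p = begin
      c           ≡⟨ s+q ⟨
      s + q       ≡⟨ cong (_+ q) a+p ⟨
      a + p + q   ≡⟨ +-assoc a p q ⟩
      a + (p + q) ≡⟨ cong (a +_) (+-comm p q) ⟩
      a + (q + p) ≡⟨ +-assoc a q p ⟨
      a + q + p   ≡⟨ cong (_+ p) size ⟨
      t + p       ∎
      where open ≡-Reasoning

    t≤c : t ≤ c
    t≤c = subst (t ≤_) (sym c≡t+p) (m≤m+n t p)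

    F₄ : ∀ i → c ≤ i → F i ≡ i
    F₄ = <-rec (λ i → c ≤ i → F i ≡ i) step
      where
      step : ∀ i → (∀ {j} → j < i → c ≤ j → F j ≡ j) → c ≤ i → F i ≡ i
      step i ih c≤i = high-step i i (≤-trans t≤c c≤i) not-below new
        where
        not-below : ¬ F i < i
        not-below Fi<i with F i <? c
        ... | no Fi≮c = <⇒≢ Fi<i (F-inj (ih Fi<i (≮⇒≥ Fi≮c)))
        ... | yes Fi<c with split (high₂ i c≤i)
        ... | l , eq = <⇒≢ (<-≤-trans a+l<s (≤-trans s≤c c≤i))
                           (F-inj (trans (F₂ l a+l<s) (sym eq)))
          where
          a+l<s : a + l < s
          a+l<s = subst (a + l <_) a+p (+-monoʳ-< a
                    (+-cancelˡ-< t l p (subst₂ _<_ eq c≡t+p Fi<c)))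

        new : ∀ j → j < i → F j ≢ i
        new j j<i eq
          with high-position j (subst (t ≤_) (sym eq) (≤-trans t≤c c≤i))
        ... | inj₂ c≤j = <⇒≢ j<i (trans (sym (ih j<i c≤j)) eq)
        ... | inj₁ (a≤j , j<s) with split a≤j
        ... | l , refl = <⇒≱ t+l<c
                           (≤-trans c≤i (≤-reflexive (trans (sym eq) (F₂ l j<s))))
          where
          t+l<c : t + l < c
          t+l<c = subst (t + l <_) (sym c≡t+p) (+-monoʳ-< t
                    (+-cancelˡ-< a l p (subst (a + l <_) (sym a+p) j<s)))

    0<q : 0 < q
    0<q with q in q≡
    ... | suc _ = z<s
    ... | zero  = contradiction F-down (<-asym (subst₂ _<_ (sym Fd≡d) (sym Fs≡s) (n<1+n d)))
      where
      c≡s : c ≡ s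
      c≡s = trans (sym s+q) (trans (cong (s +_) q≡) (+-identityʳ s))

      t≡a : t ≡ a
      t≡a = trans size (trans (cong (a +_) q≡) (+-identityʳ a))

      Fs≡s : F s ≡ s
      Fs≡s = F₄ s (≤-reflexive c≡s)

      Fd≡d : F d ≡ d
      Fd≡d with d <? a
      ... | yes d<a = F₁ d d<a
      ... | no  d≮a with split (≮⇒≥ d≮a)
      ... | l , d≡ = trans (cong F d≡)
                       (trans (F₂ l (subst (_< s) d≡ (n<1+n d)))
                         (trans (cong (_+ l) t≡a) (sym d≡)))

    0<p : 0 < p
    0<p with p in p≡
    ... | suc _ = z<s
    ... | zero  = contradiction F-down (<-asym (subst₂ _<_ (sym Fd≡d) (sym Fs≡s) (n<1+n d)))
      where
      a≡s : a ≡ s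
      a≡s = trans (sym (+-identityʳ a)) (trans (cong (a +_) (sym p≡)) a+p)

      Fd≡d : F d ≡ d
      Fd≡d = F₁ d (subst (d <_) (sym a≡s) (n<1+n d))

      s+0<c : s + 0 < c
      s+0<c = subst (s + 0 <_) s+q (+-monoʳ-< s 0<q)

      Fs≡s : F s ≡ s
      Fs≡s = trans (cong F (sym (+-identityʳ s)))
               (trans (F₃ 0 s+0<c) (trans (+-identityʳ a) a≡s))

    a<t : a < t
    a<t = subst₂ _<_ (+-identityʳ a) (sym size) (+-monoʳ-< a 0<q)

    t<c : t < c
    t<c = subst₂ _<_ (+-identityʳ t) (sym c≡t+p) (+-monoʳ-< t 0<p)

    c∸t≡p : c ∸ t ≡ p
    c∸t≡p = trans (cong (_∸ t) c≡t+p) (m+n∸m≡n t p)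

    t∸a≡q : t ∸ a ≡ q
    t∸a≡q = trans (cong (_∸ a) size) (m+n∸m≡n a q)

    F₂′ : ∀ k → k < c ∸ t → F (a + k) ≡ t + k
    F₂′ k k<c∸t = F₂ k (subst (a + k <_) a+p (+-monoʳ-< a (subst (k <_) c∸t≡p k<c∸t)))

    F₃′ : ∀ k → k < t ∸ a → F (a + (c ∸ t) + k) ≡ a + k
    F₃′ k k<t∸a = trans (cong (λ x → F (x + k)) (trans (cong (a +_) c∸t≡p) a+p))
      (F₃ k (subst (s + k <_) s+q (+-monoʳ-< s (subst (k <_) t∸a≡q k<t∸a))))

  extend : (Fin n → Fin n) → ℕ → ℕ
  extend {n} f i with i <? n
  ... | yes i<n = toℕ (f (fromℕ< i<n))
  ... | no  _   = i

  extend-toℕ : (f : Fin n → Fin n) (i : Fin n) → extend f (toℕ i) ≡ toℕ (f i)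
  extend-toℕ {n} f i with toℕ i <? n
  ... | yes i<n = cong (toℕ ∘ f) (Fin.fromℕ<-toℕ i i<n)
  ... | no  i≮n = contradiction (Fin.toℕ<n i) i≮n

  extend-id : (f : Fin n → Fin n) (i : ℕ) → n ≤ i → extend f i ≡ i
  extend-id {n} f i n≤i with i <? n
  ... | yes i<n = contradiction n≤i (<⇒≱ i<n)
  ... | no  _   = refl

  as-toℕ : ∀ {i} → i < n → ∃ λ (j : Fin n) → i ≡ toℕ j
  as-toℕ i<n = fromℕ< i<n , sym (Fin.toℕ-fromℕ< i<n)

  extend-inverse : (f g : Fin n → Fin n) → (∀ i → f (g i) ≡ i) →
                   ∀ i → extend f (extend g i) ≡ i
  extend-inverse {n} f g fg i with i <? n
  ... | yes i<n = trans (extend-toℕ f (g (fromℕ< i<n)))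
                    (trans (cong toℕ (fg _)) (Fin.toℕ-fromℕ< i<n))
  ... | no  i≮n = extend-id f i (≮⇒≥ i≮n)

  extend-≤ : (f : Fin n → Fin n) (i : ℕ) → suc i ≥ n → extend f i < suc i
  extend-≤ {n} f i n≤1+i with i <? n
  ... | yes i<n = <-≤-trans (Fin.toℕ<n _) n≤1+i
  ... | no  _   = ≤-refl

  extend-up : (ω : Permutation′ n) (D : HasExactlyOneDescent ω) →
              ∀ i → i ≢ toℕ (proj₁ D) →
              extend (ω ⟨$⟩ʳ_) i < extend (ω ⟨$⟩ʳ_) (suc i)
  extend-up {n} ω (d , _ , unique) i i≢d with ≤-<-connex n (suc i)
  ... | inj₁ n≤1+i = subst (extend (ω ⟨$⟩ʳ_) i <_) (sym (extend-id (ω ⟨$⟩ʳ_) (suc i) n≤1+i))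
                       (extend-≤ (ω ⟨$⟩ʳ_) i n≤1+i)
  ... | inj₂ 1+i<n with as-toℕ (<-trans (n<1+n i) 1+i<n) | as-toℕ 1+i<n
  ... | x , i≡x | y , 1+i≡y
    with <-cmp (toℕ (ω ⟨$⟩ʳ x)) (toℕ (ω ⟨$⟩ʳ y))
  ... | tri< lt _ _ = subst₂ _<_
          (sym (trans (cong (extend (ω ⟨$⟩ʳ_)) i≡x) (extend-toℕ (ω ⟨$⟩ʳ_) x)))
          (sym (trans (cong (extend (ω ⟨$⟩ʳ_)) 1+i≡y) (extend-toℕ (ω ⟨$⟩ʳ_) y))) lt
  ... | tri≈ _ eq _ = contradiction
          (trans i≡x (trans (cong toℕ x≡y) (sym 1+i≡y))) (<⇒≢ (n<1+n i))
    where
    x≡y : x ≡ y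
    x≡y = trans (sym (inverseˡ ω))
            (trans (cong (ω ⟨$⟩ˡ_) (Fin.toℕ-injective eq)) (inverseˡ ω))
  ... | tri> _ _ gt = contradiction
          (trans i≡x (cong toℕ (sym (unique (y , trans (sym 1+i≡y) (cong suc i≡x) , gt))))) i≢d

  extend-down : (ω : Permutation′ n) (D : HasExactlyOneDescent ω) →
                extend (ω ⟨$⟩ʳ_) (suc (toℕ (proj₁ D))) <
                extend (ω ⟨$⟩ʳ_) (toℕ (proj₁ D))
  extend-down ω (d , (j , j≡1+d , lt) , _) = subst₂ _<_
    (sym (trans (cong (extend (ω ⟨$⟩ʳ_)) (sym j≡1+d)) (extend-toℕ (ω ⟨$⟩ʳ_) j)))
    (sym (extend-toℕ (ω ⟨$⟩ʳ_) d)) lt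

abstract

  blockForm : (σ : 𝔅 n) → BlockForm (perm σ)
  blockForm {n} σ = record
    { a = B.a ; b = B.t ; c = B.c
    ; a<b = B.a<t ; b<c = B.t<c ; c≤n = B.c≤n
    ; block₁ = λ i i<a → trans (sym (extend-toℕ (ω ⟨$⟩ʳ_) i)) (B.F₁ (toℕ i) i<a)
    ; block₂ = λ i k k< eq →
        trans (sym (extend-toℕ (ω ⟨$⟩ʳ_) i)) (trans (cong (extend (ω ⟨$⟩ʳ_)) eq) (B.F₂′ k k<))
    ; block₃ = λ i k k< eq →
        trans (sym (extend-toℕ (ω ⟨$⟩ʳ_) i)) (trans (cong (extend (ω ⟨$⟩ʳ_)) eq) (B.F₃′ k k<))
    ; block₄ = λ i c≤i → trans (sym (extend-toℕ (ω ⟨$⟩ʳ_) i)) (B.F₄ (toℕ i) c≤i)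
    }
    where
    ω : Permutation′ n
    ω = perm σ
    D : HasExactlyOneDescent ω
    D = one-descent σ
    E : HasExactlyOneDescent (flip ω)
    E = one-descent-of-inv σ
    module B = Blocks
      (extend (ω ⟨$⟩ʳ_)) (extend (ω ⟨$⟩ˡ_)) n (toℕ (proj₁ D)) (toℕ (proj₁ E))
      (extend-inverse (ω ⟨$⟩ˡ_) (ω ⟨$⟩ʳ_) (λ _ → inverseˡ ω))
      (extend-inverse (ω ⟨$⟩ʳ_) (ω ⟨$⟩ˡ_) (λ _ → inverseʳ ω))
      (extend-id (ω ⟨$⟩ʳ_)) (Fin.toℕ<n (proj₁ D)) (Fin.toℕ<n (proj₁ E))
      (extend-up ω D) (extend-up (flip ω) E) (extend-down ω D)

------------------------------------------------------------------------
-- Length vector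

-- blockForm σ may be sealed without loss: the triple is determined by σ, since
-- a is its first non-fixed position, b its value there, and c - 1 its last
-- non-fixed position (0-based).
module _ (σ : 𝔅 n) where
  open BlockForm (blockForm σ)

  ℓ₁ ℓ₂ ℓ₃ ℓ₄ : ℕ
  ℓ₁ = a + 1
  ℓ₂ = b ∸ a
  ℓ₃ = c ∸ b
  ℓ₄ = n + 1 ∸ c

------------------------------------------------------------------------
-- Maximal elements below a family

IsMaximalBelow : (Fin r → 𝔅 n) → 𝔅 n → Set
IsMaximalBelow {n = n} π σ =
  (∀ j → perm σ ≤ᴮ perm (π j)) ×
  ((τ : 𝔅 n) → (∀ j → perm τ ≤ᴮ perm (π j)) → perm σ ≤ᴮ perm τ →
   perm τ ≈ₚ perm σ)

maximum minimum : .{{_ : NonZero r}} → (Fin r → ℕ) → ℕ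
maximum {suc r} f = foldr₁ _⊔_ (tabulate f)
minimum {suc r} f = foldr₁ _⊓_ (tabulate f)

{-# OPTIONS --safe #-}

-- Between bigrassmannian permutations, σ ≤ τ holds exactly when
-- ℓ₁(σ) ≥ ℓ₁(τ), ℓ₂(σ) ≤ ℓ₂(τ), ℓ₃(σ) ≤ ℓ₃(τ) and ℓ₄(σ) ≥ ℓ₄(τ).
-- The inequalities are necessary because a reduction preserves each of the
-- properties ω(x) ≤ x + ℓ₂, x ≤ ω(x) + ℓ₃, ω(x) < a → x ≤ ω(x) and
-- c ≤ ω(x) → ω(x) ≤ x.  They are sufficient because moving a unit from ℓ₂ or
-- ℓ₃ to ℓ₁ or ℓ₄ is a chain of reductions cycling one entry through a block.
-- As ℓ₁ + ℓ₂ + ℓ₃ + ℓ₄ = n + 2, and every positive vector with this sum is a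
-- length vector, what remains is a statement about vectors in ℕ⁴.
module Submission where

open import Defs
open import Data.Fin.Base as Fin using (Fin; toℕ; fromℕ<)
open import Data.Fin.Permutation
  using (Permutation′; permutation; _⟨$⟩ʳ_; _⟨$⟩ˡ_; flip; transpose; _∘ₚ_;
         inverseˡ; inverseʳ)
  renaming (_≈_ to _≈ₚ_)
import Data.Fin.Properties as Fin
open import Data.Nat.Base
open import Data.Nat.Properties
open import Data.Nat.Tactic.RingSolver using (solve-∀)
open import Data.Product.Base using (∃; _×_; _,_; proj₁; proj₂)
open import Data.Sum.Base using (_⊎_; inj₁; inj₂)
open import Function.Base using (_∘_)
open import Function.Bundles using (_⇔_; mk⇔; Equivalence)
open import Relation.Binary.Construct.Closure.ReflexiveTransitive
  using (Star; ε; _◅_; _◅◅_; gmap)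
open import Relation.Binary.PropositionalEquality
open import Relation.Nullary using (yes; no; contradiction)

private
  variable
    n r : ℕ

-- Transpositions, reductions and inversion

-- The last index is the image of `k` under the transposition, so a match on the view both selects
-- the case and computes the image.
data TransposeView (i j k : Fin n) : Fin n → Set where
  at-left  : k ≡ i → TransposeView i j k j
  at-right : k ≡ j → TransposeView i j k i
  elsewhere : k ≢ i → k ≢ j → TransposeView i j k k

transposeView : (i j k : Fin n) → TransposeView i j k (transpose i j ⟨$⟩ʳ k)
transposeView i j k with k Fin.≟ i
... | yes k≡i = at-left k≡i
... | no  k≢i with k Fin.≟ j
...   | yes k≡j = at-right k≡j
...   | no  k≢j = elsewhere k≢i k≢j

⟨$⟩ʳ-injective : (ω : Permutation′ n) {i j : Fin n} → ω ⟨$⟩ʳ i ≡ ω ⟨$⟩ʳ j → i ≡ j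
⟨$⟩ʳ-injective ω eq =
  trans (sym (inverseˡ ω)) (trans (cong (ω ⟨$⟩ˡ_) eq) (inverseˡ ω))

-- Interchanging the entries at positions `i < j` of `ω` interchanges the values `i` and `j` in the
-- inverse. These stand there at positions `ω(j) < ω(i)` in the order `j`, `i`, hence again form an
-- inversion.
flip-reduction : {ω ω′ : Permutation′ n} →
                 Reduction ω ω′ → Reduction (flip ω) (flip ω′)
flip-reduction {ω = ω} {ω′} (i , j , i<j , ωj<ωi , ω′≈) =
  ω ⟨$⟩ʳ j , ω ⟨$⟩ʳ i , ωj<ωi ,
  subst₂ Fin._<_ (sym (inverseˡ ω)) (sym (inverseˡ ω)) i<j ,
  -- Both sides are compared after applying `ω′`, which reduces the claim to `transposed`.
  λ v → ⟨$⟩ʳ-injective ω′ (trans (inverseʳ ω′)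
          (sym (trans (ω′≈ _) (transposed v (transposeView _ _ v)))))
  where
  transposed : ∀ v {w} → TransposeView (ω ⟨$⟩ʳ j) (ω ⟨$⟩ʳ i) v w →
               ω ⟨$⟩ʳ (transpose i j ⟨$⟩ʳ (ω ⟨$⟩ˡ w)) ≡ v
  transposed v {w} view
    with transpose i j ⟨$⟩ʳ (ω ⟨$⟩ˡ w) | transposeView i j (ω ⟨$⟩ˡ w) | view
  ... | _ | at-left  _  | at-left v≡    = sym v≡
  ... | _ | at-right eq | at-left v≡    =
    trans (cong (ω ⟨$⟩ʳ_) (trans (sym (inverseˡ ω)) eq)) (sym v≡)
  ... | _ | elsewhere ≢i _   | at-left _     = contradiction (inverseˡ ω) ≢i
  ... | _ | at-left  eq | at-right v≡   =
    trans (cong (ω ⟨$⟩ʳ_) (trans (sym (inverseˡ ω)) eq)) (sym v≡)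
  ... | _ | at-right _  | at-right v≡   = sym v≡
  ... | _ | elsewhere _ ≢j   | at-right _    = contradiction (inverseˡ ω) ≢j
  ... | _ | at-left  eq | elsewhere _ v≢ωi   =
    contradiction (trans (sym (inverseʳ ω)) (cong (ω ⟨$⟩ʳ_) eq)) v≢ωi
  ... | _ | at-right eq | elsewhere v≢ωj _   =
    contradiction (trans (sym (inverseʳ ω)) (cong (ω ⟨$⟩ʳ_) eq)) v≢ωj
  ... | _ | elsewhere _ _    | elsewhere _ _      = inverseʳ ω

-- Properties inherited downwards in Bruhat order

-- Relations between positions and values which survive every reduction.
Uncrossing : (ℕ → ℕ → Set) → Set
Uncrossing R = ∀ {i j x y} → i < j → y < x → R i x → R j y → R i y × R j x

Holds : (ℕ → ℕ → Set) → Permutation′ n → Set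
Holds R ω = ∀ i → R (toℕ i) (toℕ (ω ⟨$⟩ʳ i))

reduction-preserves : {R : ℕ → ℕ → Set} → Uncrossing R →
  {ω ω′ : Permutation′ n} → Reduction ω ω′ → Holds R ω → Holds R ω′
reduction-preserves {R = R} unc {ω} {ω′} (i , j , i<j , ωj<ωi , ω′≈) h k =
  subst (R (toℕ k) ∘ toℕ) (sym (ω′≈ k)) (transposed (transposeView i j k))
  where
  transposed : ∀ {l} → TransposeView i j k l → R (toℕ k) (toℕ (ω ⟨$⟩ʳ l))
  transposed (at-left refl)  = proj₁ (unc i<j ωj<ωi (h i) (h j))
  transposed (at-right refl) = proj₂ (unc i<j ωj<ωi (h i) (h j))
  transposed (elsewhere _ _)     = h k

≤ᴮ-preserves : {R : ℕ → ℕ → Set} → Uncrossing R →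
               {σ ω : Permutation′ n} → σ ≤ᴮ ω → Holds R ω → Holds R σ
≤ᴮ-preserves {R = R} unc (ρ , reds , ρ≈σ) h i =
  subst (R (toℕ i) ∘ toℕ) (ρ≈σ i) (go reds h i)
  where
  go : ∀ {ω ρ : Permutation′ _} → Star Reduction ω ρ → Holds R ω → Holds R ρ
  go ε            h = h
  go (_◅_ {ω₀} {ω₁} red reds) h =
    go reds (reduction-preserves {R = R} unc {ω₀} {ω₁} red h)

-- Permutations as functions on ℕ, and chains of swaps

-- Functions on ℕ carry no bounds, so positions are handled by plain arithmetic; the values of `f`
-- at arguments from `n` on are irrelevant.
record Represents (ω : Permutation′ n) (f : ℕ → ℕ) : Set where
  constructor represents
  field
    value : ∀ i → toℕ (ω ⟨$⟩ʳ i) ≡ f (toℕ i)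

open Represents

represents-≈ : {ω ω′ : Permutation′ n} {f : ℕ → ℕ} →
               Represents ω f → Represents ω′ f → ω ≈ₚ ω′
represents-≈ h h′ i = Fin.toℕ-injective (trans (value h i) (sym (value h′ i)))

swapAt : ℕ → ℕ → (ℕ → ℕ) → ℕ → ℕ
swapAt i j f x with x ≟ i
... | yes _ = f j
... | no  _ with x ≟ j
...   | yes _ = f i
...   | no  _ = f x

swapAt-left : ∀ i j f → swapAt i j f i ≡ f j
swapAt-left i j f with i ≟ i
... | yes _   = refl
... | no  i≢i = contradiction refl i≢i

swapAt-right : ∀ i j f → swapAt i j f j ≡ f i
swapAt-right i j f with j ≟ i
... | yes refl = refl
... | no  _ with j ≟ j
...   | yes _   = refl
...   | no  j≢j = contradiction refl j≢j

swapAt-away : ∀ {i j x} f → x ≢ i → x ≢ j → swapAt i j f x ≡ f x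
swapAt-away {i} {j} {x} f x≢i x≢j with x ≟ i
... | yes x≡i = contradiction x≡i x≢i
... | no  _ with x ≟ j
...   | yes x≡j = contradiction x≡j x≢j
...   | no  _   = refl

swap-reduction : {ω : Permutation′ n} {f : ℕ → ℕ} {i j : ℕ} → Represents ω f →
  i < j → j < n → f j < f i →
  ∃ λ ω′ → Reduction ω ω′ × Represents ω′ (swapAt i j f)
swap-reduction {n} {ω} {f} {i} {j} h i<j j<n fj<fi =
  transpose i′ j′ ∘ₚ ω ,
  (i′ , j′ , subst₂ _<_ (sym toℕi′) (sym toℕj′) i<j ,
   subst₂ _<_ (sym (trans (value h j′) (cong f toℕj′)))
     (sym (trans (value h i′) (cong f toℕi′))) fj<fi ,
   λ _ → refl) ,
  represents λ k → trans (value h _) (swapped k (transposeView i′ j′ k))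
  where
  i<n : i < n
  i<n = <-trans i<j j<n
  i′ j′ : Fin n
  i′ = fromℕ< i<n
  j′ = fromℕ< j<n
  toℕi′ : toℕ i′ ≡ i
  toℕi′ = Fin.toℕ-fromℕ< i<n
  toℕj′ : toℕ j′ ≡ j
  toℕj′ = Fin.toℕ-fromℕ< j<n
  swapped : ∀ k {l} → TransposeView i′ j′ k l → f (toℕ l) ≡ swapAt i j f (toℕ k)
  swapped k (at-left refl)  =
    trans (cong f toℕj′) (sym (trans (cong (swapAt i j f) toℕi′) (swapAt-left i j f)))
  swapped k (at-right refl) =
    trans (cong f toℕi′) (sym (trans (cong (swapAt i j f) toℕj′) (swapAt-right i j f)))
  swapped k (elsewhere k≢i′ k≢j′)  = sym (swapAt-away f
    (λ eq → k≢i′ (Fin.toℕ-injective (trans eq (sym toℕi′))))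
    (λ eq → k≢j′ (Fin.toℕ-injective (trans eq (sym toℕj′)))))

ReducesTo : Permutation′ n → (ℕ → ℕ) → Set
ReducesTo ω g = ∃ λ ρ → Star Reduction ω ρ × Represents ρ g

-- The entry u 0 at position q is exchanged with the entries u 1 < … < u k at
-- positions p, …, p + k - 1 in turn, so each of these moves one place on.
cycle-reduces : ∀ k p {q} {f g : ℕ → ℕ} {ω : Permutation′ n} (u : ℕ → ℕ) →
  Represents ω f → q < n → p + k ≤ q →
  (∀ j → j < k → u j < u (suc j)) →
  f q ≡ u 0 → (∀ j → j < k → f (p + j) ≡ u (suc j)) →
  g q ≡ u k → (∀ j → j < k → g (p + j) ≡ u j) →
  (∀ x → x ≢ q → x < p ⊎ p + k ≤ x → f x ≡ g x) →
  ReducesTo ω g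
cycle-reduces zero p {q} {f} {g} {ω} u h _ _ _ fq _ gq _ away =
  ω , ε , represents λ i → trans (value h i) (f≡g (toℕ i))
  where
  f≡g : ∀ x → f x ≡ g x
  f≡g x with x ≟ q
  ... | yes refl = trans fq (sym gq)
  ... | no  x≢q with x <? p
  ...   | yes x<p = away x x≢q (inj₁ x<p)
  ...   | no  x≮p = away x x≢q (inj₂ (≤-trans (≤-reflexive (+-identityʳ p)) (≮⇒≥ x≮p)))
cycle-reduces {n} (suc k) p {q} {f} {g} {ω} u h q<n p+k≤q u-up fq fp gq gp away
  with swap-reduction {ω = ω} {f} h p<q q<n
         (subst₂ _<_ (sym fq) (sym fp₀) (u-up 0 z<s))
  where
  p<q : p < q
  p<q = <-≤-trans (m<m+n p z<s) p+k≤q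
  fp₀ : f p ≡ u 1
  fp₀ = trans (cong f (sym (+-identityʳ p))) (fp 0 z<s)
... | ω₁ , red , h₁
  -- After the first exchange position `p` has its final entry `u 0` and position `q` holds `u 1`,
  -- so what remains is the same cycle for the shifted sequence, starting at `suc p`.
  with cycle-reduces k (suc p) {g = g} (u ∘ suc) h₁ q<n
         (≤-trans (≤-reflexive (sym (+-suc p k))) p+k≤q)
         (λ j j<k → u-up (suc j) (s<s j<k))
         (trans (swapAt-right p q f)
           (trans (cong f (sym (+-identityʳ p))) (fp 0 z<s)))
         (λ j j<k → trans
           (swapAt-away f (>⇒≢ (s≤s (m≤m+n p j)))
             (<⇒≢ (<-≤-trans (subst (_< p + suc k) (+-suc p j)
                                (+-monoʳ-< p (s<s j<k))) p+k≤q)))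
           (trans (cong f (sym (+-suc p j))) (fp (suc j) (s<s j<k))))
         gq
         (λ j j<k → trans (cong g (sym (+-suc p j))) (gp (suc j) (s<s j<k)))
         away₁
  where
  away₁ : ∀ x → x ≢ q → x < suc p ⊎ suc p + k ≤ x → swapAt p q f x ≡ g x
  away₁ x x≢q side with x ≟ p
  ... | yes refl = trans fq
    (trans (sym (gp 0 z<s)) (cong g (+-identityʳ p)))
  ... | no  x≢p with x ≟ q
  ...   | yes x≡q = contradiction x≡q x≢q
  ...   | no _ with side
  ...     | inj₁ x<1+p = away x x≢q (inj₁ (≤∧≢⇒< (s≤s⁻¹ x<1+p) x≢p))
  ...     | inj₂ ≤x    = away x x≢q (inj₂ (≤-trans (≤-reflexive (+-suc p k)) ≤x))
... | ρ , reds , hρ = ρ , red ◅ reds , hρ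

-- Block rotations

-- The relation y = ω(x) of the element ω of 𝔅 n with ℓ₁ = a + 1, ℓ₂ = l and
-- ℓ₃ = m, which swaps the adjacent blocks [a, a + m) and [a + m, a + m + l).
data Rot (a l m x y : ℕ) : Set where
  before : x < a → y ≡ x → Rot a l m x y
  left   : ∀ k → k < m → x ≡ a + k → y ≡ a + l + k → Rot a l m x y
  right  : ∀ k → k < l → x ≡ a + m + k → y ≡ a + k → Rot a l m x y
  after  : a + l + m ≤ x → y ≡ x → Rot a l m x y

+-swapʳ : ∀ a l m → a + l + m ≡ a + m + l
+-swapʳ = solve-∀

-- The exchange of ℓ₂ and ℓ₃ is inversion.
Rot-sym : ∀ {a l m x y} → Rot a l m x y → Rot a m l y x
Rot-sym (before x<a refl)       = before x<a refl
Rot-sym (left k k<m x≡ y≡)      = right k k<m y≡ x≡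
Rot-sym (right k k<l x≡ y≡)     = left k k<l y≡ x≡
Rot-sym {a} {l} {m} {x} (after ≤x refl) =
  after (subst (_≤ x) (+-swapʳ a l m) ≤x) refl

abstract

  -- The function with graph `Rot`. Being abstract, it is accessible later only through `rot-Rot`
  -- and `Rot⇒rot`, that is, by cases on blocks instead of comparisons.
  rot : ℕ → ℕ → ℕ → ℕ → ℕ
  rot a l m x with x <? a | x <? a + m | x <? a + m + l
  ... | yes _ | _     | _     = x
  ... | no  _ | yes _ | _     = x + l
  ... | no  _ | no  _ | yes _ = x ∸ m
  ... | no  _ | no  _ | no  _ = x

  rot-Rot : ∀ a l m x → Rot a l m x (rot a l m x)
  rot-Rot a l m x with x <? a | x <? a + m | x <? a + m + l
  ... | yes x<a | _     | _     = before x<a refl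
  ... | no  x≮a | yes x< | _     =
    left (x ∸ a) (+-cancelˡ-< a _ m (subst (_< a + m) (sym eq) x<)) (sym eq)
      (trans (cong (_+ l) (sym eq)) (+-swapʳ a (x ∸ a) l))
    where
    eq : a + (x ∸ a) ≡ x
    eq = m+[n∸m]≡n (≮⇒≥ x≮a)
  ... | no  _   | no  x≮ | yes x< =
    right k (+-cancelˡ-< (a + m) k l (subst (_< a + m + l) (sym eq) x<)) (sym eq)
      (trans (cong (_∸ m) (trans (sym eq) (+-swapʳ a m k))) (m+n∸n≡m (a + k) m))
    where
    k : ℕ
    k = x ∸ (a + m)
    eq : a + m + k ≡ x
    eq = m+[n∸m]≡n (≮⇒≥ x≮)
  ... | no  _   | no  _  | no x≮ =
    after (≤-trans (≤-reflexive (+-swapʳ a l m)) (≮⇒≥ x≮)) refl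

  -- The four ranges of positions are disjoint, so a block and an outcome of the comparisons that
  -- disagree are contradictory. Values of `rot` are computed by exhibiting the block of the
  -- position.
  Rot⇒rot : ∀ {a l m x y} → Rot a l m x y → rot a l m x ≡ y
  Rot⇒rot {a} {l} {m} {x} R with x <? a | x <? a + m | x <? a + m + l
  Rot⇒rot (before _ y≡) | yes _ | _ | _ = sym y≡
  Rot⇒rot (left k _ refl _) | yes x<a | _ | _ = contradiction x<a (m+n≮m _ k)
  Rot⇒rot {a} {m = m} (right k _ refl _) | yes x<a | _ | _ =
    contradiction (≤-<-trans (m≤m+n a m) (≤-<-trans (m≤m+n (a + m) k) x<a)) (<-irrefl refl)
  Rot⇒rot (after _ y≡) | yes _ | _ | _ = sym y≡
  Rot⇒rot (before x<a _) | no x≮a | _ | _ = contradiction x<a x≮a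
  Rot⇒rot {a} {l} (left k _ refl refl) | no _ | yes _ | _ = +-swapʳ a k l
  Rot⇒rot {a} {m = m} (right k _ refl _) | no _ | yes x< | _ =
    contradiction x< (m+n≮m (a + m) k)
  Rot⇒rot {a} {l} {m} (after ≤x _) | no _ | yes x< | _ =
    contradiction (<-≤-trans x< (≤-trans (+-monoˡ-≤ m (m≤m+n a l)) ≤x)) (<-irrefl refl)
  Rot⇒rot {a} (left k k<m refl _) | no _ | no x≮ | _ = contradiction (+-monoʳ-< a k<m) x≮
  Rot⇒rot {a} {m = m} (right k _ refl refl) | no _ | no _ | yes _ =
    trans (cong (_∸ m) (+-swapʳ a m k)) (m+n∸n≡m (a + k) m)
  Rot⇒rot {a} {l} {m} {x} (after ≤x _) | no _ | no _ | yes x< =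
    contradiction (<-≤-trans x< (subst (_≤ x) (+-swapʳ a l m) ≤x)) (<-irrefl refl)
  Rot⇒rot {a} {m = m} (right k k<l refl _) | no _ | no _ | no x≮ =
    contradiction (+-monoʳ-< (a + m) k<l) x≮
  Rot⇒rot (after _ y≡) | no _ | no _ | no _ = sym y≡

rot-rot : ∀ a l m x → rot a m l (rot a l m x) ≡ x
rot-rot a l m x = Rot⇒rot (Rot-sym (rot-Rot a l m x))

Represents-flip : ∀ {ω : Permutation′ n} {a l m} →
                  Represents ω (rot a l m) → Represents (flip ω) (rot a m l)
Represents-flip {ω = ω} {a} {l} {m} h = represents λ j → sym
  (trans (cong (rot a m l) (trans (cong toℕ (sym (inverseʳ ω))) (value h (ω ⟨$⟩ˡ j))))
         (rot-rot a l m _))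

-- Reduction chains between rotations

-- A unit moves from ℓ₂ to ℓ₁: the smallest entry `a` of the right block, at position `a + m`,
-- travels to position `a` and becomes a fixed point, while the left block shifts one place on.
step-a-l : ∀ {ω : Permutation′ n} a l m → a + suc l + m ≤ n →
           Represents ω (rot a (suc l) m) → ReducesTo ω (rot (suc a) l m)
step-a-l {n} {ω} a l m ≤n h = cycle-reduces m a {a + m} {g = rot (suc a) l m} u h
  q<n ≤-refl u-up
  (Rot⇒rot (right 0 z<s (sym (+-identityʳ _)) (sym (+-identityʳ a))))
  (λ j j<m → Rot⇒rot (left j j<m refl refl))
  (gq m) gp away
  where
  -- The travelling entry, followed by the entries of the left block.
  u : ℕ → ℕ
  u zero    = a
  u (suc j) = a + suc l + j
  q<n : a + m < n
  q<n = <-≤-trans (+-monoˡ-< m (m<m+n a z<s)) ≤n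
  u-up : ∀ j → j < m → u j < u (suc j)
  u-up zero    _ = <-≤-trans (m<m+n a z<s) (m≤m+n (a + suc l) 0)
  u-up (suc j) _ = +-monoʳ-< (a + suc l) (n<1+n j)
  a+l : ∀ j → a + suc l + j ≡ suc a + l + j
  a+l j = cong (_+ j) (+-suc a l)
  gp : ∀ j → j < m → rot (suc a) l m (a + j) ≡ u j
  gp zero    _   = trans (cong (rot (suc a) l m) (+-identityʳ a)) (Rot⇒rot (before ≤-refl refl))
  gp (suc j) j<m = Rot⇒rot (left j (<⇒≤ j<m) (+-suc a j) (a+l j))
  -- The position vacated by `a` receives the last entry of the left block, or keeps `a` if that
  -- block is empty.
  gq : ∀ m′ → rot (suc a) l m′ (a + m′) ≡ u m′
  gq zero     = trans (cong (rot (suc a) l 0) (+-identityʳ a)) (Rot⇒rot (before ≤-refl refl))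
  gq (suc m′) = Rot⇒rot (left m′ ≤-refl (+-suc a m′) (a+l m′))
  away : ∀ x → x ≢ a + m → x < a ⊎ a + m ≤ x → rot a (suc l) m x ≡ rot (suc a) l m x
  away x x≢q side with rot-Rot a (suc l) m x
  ... | before x<a eq = trans eq (sym (Rot⇒rot (before (m<n⇒m<1+n x<a) refl)))
  ... | after ≤x eq = trans eq (sym (Rot⇒rot (after (≤-trans (≤-reflexive (sym (a+l m))) ≤x) refl)))
  ... | right zero _ x≡ _ = contradiction (trans x≡ (+-identityʳ _)) x≢q
  ... | right (suc k) k<l x≡ eq = trans eq (sym (Rot⇒rot (right k (s<s⁻¹ k<l)
          (trans x≡ (+-suc (a + m) k)) (+-suc a k))))
  ... | left k k<m refl _ with side
  ...   | inj₁ x<a = contradiction x<a (m+n≮m a k)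
  ...   | inj₂ ≤x  = contradiction (+-cancelˡ-≤ a m k ≤x) (<⇒≱ k<m)

-- A unit moves from ℓ₂ to ℓ₄: the largest entry `a + l` of the right block, at its last position,
-- travels to the front of the left block. The value `a + l + m` is left at the vacated position and
-- is fixed there.
step-l : ∀ {ω : Permutation′ n} a l m → a + suc l + m ≤ n →
         Represents ω (rot a (suc l) m) → ReducesTo ω (rot a l m)
step-l {n} {ω} a l m ≤n h = cycle-reduces m a {a + m + l} {g = rot a l m} (λ j → a + l + j) h
  q<n (m≤m+n (a + m) l) (λ j _ → +-monoʳ-< (a + l) (n<1+n j))
  (Rot⇒rot (right l ≤-refl refl (+-identityʳ _)))
  (λ j j<m → Rot⇒rot (left j j<m refl (a+l j)))
  (trans (Rot⇒rot (after (≤-reflexive (+-swapʳ a l m)) refl)) (+-swapʳ a m l))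
  (λ j j<m → Rot⇒rot (left j j<m refl refl)) away
  where
  a+l : ∀ j → a + l + suc j ≡ a + suc l + j
  a+l j = trans (+-suc (a + l) j) (cong (_+ j) (sym (+-suc a l)))
  top : suc (a + l + m) ≡ a + suc l + m
  top = cong (_+ m) (sym (+-suc a l))
  q<n : a + m + l < n
  q<n = subst (_< n) (+-swapʳ a l m) (subst (_≤ n) (sym top) ≤n)
  away : ∀ x → x ≢ a + m + l → x < a ⊎ a + m ≤ x → rot a (suc l) m x ≡ rot a l m x
  away x x≢q side with rot-Rot a (suc l) m x
  ... | before x<a eq = trans eq (sym (Rot⇒rot (before x<a refl)))
  ... | after ≤x eq = trans eq (sym (Rot⇒rot (after
          (≤-trans (n≤1+n _) (≤-trans (≤-reflexive top) ≤x)) refl)))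
  ... | right k k<1+l x≡ eq = trans eq (sym (Rot⇒rot (right k
          (≤∧≢⇒< (s≤s⁻¹ k<1+l) (λ { refl → x≢q x≡ })) x≡ refl)))
  ... | left k k<m refl _ with side
  ...   | inj₁ x<a = contradiction x<a (m+n≮m a k)
  ...   | inj₂ ≤x  = contradiction (+-cancelˡ-≤ a m k ≤x) (<⇒≱ k<m)

-- Inversion respects reductions and exchanges ℓ₂ with ℓ₃, so the moves out of ℓ₃ follow from those
-- out of ℓ₂.
flip-ReducesTo : ∀ {ω : Permutation′ n} {a l m} →
  ReducesTo (flip ω) (rot a m l) → ReducesTo ω (rot a l m)
flip-ReducesTo (ρ , reds , hρ) =
  flip ρ , gmap flip (λ {ω} {ω′} → flip-reduction {ω = ω} {ω′}) reds , Represents-flip {ω = ρ} hρ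

module _ {ω : Permutation′ n} (a l m : ℕ) (≤n : a + l + suc m ≤ n)
         (h : Represents ω (rot a l (suc m))) where

  private
    ≤n′ : a + suc m + l ≤ n
    ≤n′ = subst (_≤ n) (+-swapʳ a l (suc m)) ≤n

  step-a-m : ReducesTo ω (rot (suc a) l m)
  step-a-m = flip-ReducesTo (step-a-l {ω = flip ω} a m l ≤n′ (Represents-flip {ω = ω} h))

  step-m : ReducesTo ω (rot a l m)
  step-m = flip-ReducesTo (step-l {ω = flip ω} a m l ≤n′ (Represents-flip {ω = ω} h))

infixr 5 _▷_

_▷_ : ∀ {ω : Permutation′ n} {f g} → ReducesTo ω f →
      (∀ {ρ : Permutation′ n} → Represents ρ f → ReducesTo ρ g) → ReducesTo ω g
(ρ , reds , hρ) ▷ next with next hρ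
... | ρ′ , reds′ , hρ′ = ρ′ , reds ◅◅ reds′ , hρ′

-- Here `λ′` and `μ` count the units leaving ℓ₂ and ℓ₃, and `α` those of them that go to ℓ₁; the
-- others go to ℓ₄. Units leave ℓ₂ before ℓ₃ and enter ℓ₁ before ℓ₄.
descend : ∀ {ω : Permutation′ n} α λ′ μ a l m → α ≤ λ′ + μ →
  a + (λ′ + l) + (μ + m) ≤ n →
  Represents ω (rot a (λ′ + l) (μ + m)) → ReducesTo ω (rot (α + a) l m)
descend zero zero zero a l m _ _ h = _ , ε , h
descend {n} zero zero (suc μ) a l m _ ≤n h =
  step-m a l (μ + m) ≤n h ▷
  descend zero zero μ a l m z≤n (≤-trans (+-monoʳ-≤ (a + l) (n≤1+n (μ + m))) ≤n)
descend zero (suc λ′) μ a l m _ ≤n h =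
  step-l a (λ′ + l) (μ + m) ≤n h ▷
  descend zero λ′ μ a l m z≤n
    (≤-trans (+-monoˡ-≤ (μ + m) (+-monoʳ-≤ a (n≤1+n (λ′ + l)))) ≤n)
descend {n} {ω} (suc α) zero (suc μ) a l m (s≤s α≤) ≤n h =
  subst (λ x → ReducesTo ω (rot x l m)) (+-suc α a)
    (step-a-m a l (μ + m) ≤n h ▷
     descend α zero μ (suc a) l m α≤ (subst (_≤ n) (+-suc (a + l) (μ + m)) ≤n))
descend {n} {ω} (suc α) (suc λ′) μ a l m (s≤s α≤) ≤n h =
  subst (λ x → ReducesTo ω (rot x l m)) (+-suc α a)
    (step-a-l a (λ′ + l) (μ + m) ≤n h ▷
     descend α λ′ μ (suc a) l m α≤
       (subst (λ x → x + (μ + m) ≤ n) (+-suc a (λ′ + l)) ≤n))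

reducesTo : ∀ {ω : Permutation′ n} {a l m a′ l′ m′} →
  a ≤ a′ → l′ ≤ l → m′ ≤ m → a′ + l′ + m′ ≤ a + l + m → a + l + m ≤ n →
  Represents ω (rot a l m) → ReducesTo ω (rot a′ l′ m′)
reducesTo {a = a} {a′ = a′} {l′} {m′} a≤a′ l′≤l m′≤m sum≤ ≤n h
  with ≤⇒∃+ a≤a′ | ≤⇒∃+ l′≤l | ≤⇒∃+ m′≤m
  where
  ≤⇒∃+ : ∀ {x y} → x ≤ y → ∃ λ d → y ≡ d + x
  ≤⇒∃+ {x} {y} x≤y = y ∸ x , sym (m∸n+n≡m x≤y)
... | α , refl | λ′ , refl | μ , refl =
  -- Cancelling `a + l′ + m′` turns the bound on the sums into the condition that ℓ₁ gains at most
  -- what ℓ₂ and ℓ₃ lose.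
  descend α λ′ μ a l′ m′ (+-cancelʳ-≤ (a + l′ + m′) α (λ′ + μ)
    (subst₂ _≤_ (lhs α a l′ m′) (rhs λ′ μ a l′ m′) sum≤)) ≤n h
  where
  lhs : ∀ α a l m → α + a + l + m ≡ α + (a + l + m)
  lhs = solve-∀
  rhs : ∀ d e a l m → a + (d + l) + (e + m) ≡ d + e + (a + l + m)
  rhs = solve-∀

-- Necessity of the four inequalities

Rot-upper : ∀ {a l m x y} → Rot a l m x y → y ≤ x + l
Rot-upper {l = l} (before _ refl)       = m≤m+n _ l
Rot-upper {a} {l} (left k _ refl refl)  = ≤-reflexive (+-swapʳ a l k)
Rot-upper {a} {l} {m} (right k _ refl refl) =
  ≤-trans (+-monoˡ-≤ k (m≤m+n a m)) (m≤m+n (a + m + k) l)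
Rot-upper {l = l} (after _ refl)        = m≤m+n _ l

-- Entries with values below `a` are in fact fixed, but equality of `x` and `y` would not give an
-- `Uncrossing` relation, whereas `x ≤ y` does.
Rot-low : ∀ {a l m x y} → Rot a l m x y → y < a → x ≤ y
Rot-low (before _ refl) _ = ≤-refl
Rot-low {a} {l} (left k _ _ refl) y<a =
  contradiction (subst (_< a) (+-assoc a l k) y<a) (m+n≮m a (l + k))
Rot-low {a} (right k _ _ refl) y<a = contradiction y<a (m+n≮m a k)
Rot-low (after _ refl) _ = ≤-refl

Rot-high : ∀ {a l m x y} → Rot a l m x y → a + l + m ≤ y → y ≤ x
Rot-high (before _ refl) _ = ≤-refl
Rot-high {a} {l} {m} (left k k<m _ refl) ≤y =
  contradiction k<m (≤⇒≯ (+-cancelˡ-≤ (a + l) m k ≤y))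
Rot-high {a} {l} {m} (right k k<l _ refl) ≤y =
  contradiction k<l (≤⇒≯ (+-cancelˡ-≤ a l k (≤-trans (m≤m+n (a + l) m) ≤y)))
Rot-high (after _ refl) _ = ≤-refl

holds-Rot : ∀ {R : ℕ → ℕ → Set} {ω : Permutation′ n} {a l m} →
  Represents ω (rot a l m) → (∀ {x y} → Rot a l m x y → R x y) → Holds R ω
holds-Rot {R = R} {a = a} {l} {m} h Rot⇒R i =
  subst (R (toℕ i)) (sym (value h i)) (Rot⇒R (rot-Rot a l m (toℕ i)))

Rot-holds : ∀ {R : ℕ → ℕ → Set} {ω : Permutation′ n} {a l m x y} →
  Represents ω (rot a l m) → Holds R ω → x < n → Rot a l m x y → R x y
Rot-holds {R = R} {a = a} {l} {m} h hR x<n xy =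
  subst₂ R (Fin.toℕ-fromℕ< x<n)
    (trans (value h _) (trans (cong (rot a l m) (Fin.toℕ-fromℕ< x<n)) (Rot⇒rot xy)))
    (hR (fromℕ< x<n))

module _ {σ ω : Permutation′ n} {a l m a′ l′ m′ : ℕ} (σ≤ω : σ ≤ᴮ ω)
         (hω : Represents ω (rot a l m)) (hσ : Represents σ (rot a′ (suc l′) (suc m′)))
         (≤n : a′ + suc l′ + suc m′ ≤ n) where

  private
    -- Each of the four inequalities applies this to one relation and to one well-chosen entry of
    -- `σ`.
    inherit : {R : ℕ → ℕ → Set} → Uncrossing R →
              (∀ {x y} → Rot a l m x y → R x y) →
              ∀ {x y} → x < n → Rot a′ (suc l′) (suc m′) x y → R x y
    inherit {R} unc Rot⇒R = Rot-holds {R = R} hσ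
      (≤ᴮ-preserves {R = R} unc {σ} {ω} σ≤ω (holds-Rot {R = R} hω Rot⇒R))

    first-left : Rot a′ (suc l′) (suc m′) a′ (a′ + suc l′)
    first-left = left 0 z<s (sym (+-identityʳ a′)) (sym (+-identityʳ _))

    last-left : Rot a′ (suc l′) (suc m′) (a′ + m′) (a′ + suc l′ + m′)
    last-left = left m′ ≤-refl refl refl

    first-right : Rot a′ (suc l′) (suc m′) (a′ + suc m′) a′
    first-right = right 0 z<s (sym (+-identityʳ _)) (sym (+-identityʳ a′))

    a+m<n : a′ + suc m′ < n
    a+m<n = <-≤-trans (+-monoˡ-< (suc m′) (m<m+n a′ z<s)) ≤n

  -- The entries in the left block of `σ` exceed their positions by `suc l′`, and no entry of `ω`
  -- exceeds its position by more than `l`.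
  ≤ᴮ⇒l≤ : suc l′ ≤ l
  ≤ᴮ⇒l≤ = +-cancelˡ-≤ a′ (suc l′) l (inherit {R = λ x y → y ≤ x + l}
    (λ i<j y<x x≤ _ → <⇒≤ (<-≤-trans y<x x≤) , ≤-trans x≤ (+-monoˡ-≤ l (<⇒≤ i<j)))
    Rot-upper (≤-<-trans (m≤m+n a′ (suc m′)) a+m<n) first-left)

  -- Dually, the entries in the right block of `σ` lie `suc m′` below their positions.
  ≤ᴮ⇒m≤ : suc m′ ≤ m
  ≤ᴮ⇒m≤ = +-cancelˡ-≤ a′ (suc m′) m (inherit {R = λ x y → x ≤ y + m}
    (λ i<j y<x _ j≤ → <⇒≤ (<-≤-trans i<j j≤) , ≤-trans j≤ (+-monoˡ-≤ m (<⇒≤ y<x)))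
    (λ xy → Rot-upper (Rot-sym xy)) a+m<n first-right)

  -- The value `a′` stands in `σ` at a position greater than `a′`. If it were below `a`, the
  -- inherited relation would forbid this.
  ≤ᴮ⇒a≥ : a ≤ a′
  ≤ᴮ⇒a≥ = ≮⇒≥ λ a′<a → m+1+n≰m a′ (inherit {R = λ x y → y < a → x ≤ y}
    (λ i<j y<x _ j≤ → (λ y<a → <⇒≤ (<-≤-trans i<j (j≤ y<a))) ,
                      (λ x<a → <⇒≤ (≤-<-trans (j≤ (<-trans y<x x<a)) y<x)))
    Rot-low a+m<n first-right a′<a)

  -- The last entry of the left block of `σ` is one less than the sum on the left and exceeds its
  -- position. Were that sum the larger one, the entry would be at least `a + l + m` and so could
  -- not exceed its position.
  ≤ᴮ⇒sum≤ : a′ + suc l′ + suc m′ ≤ a + l + m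
  ≤ᴮ⇒sum≤ = ≮⇒≥ λ c<c′ → m+1+n≰m (a′ + m′) (subst (_≤ a′ + m′) (+-swapʳ a′ (suc l′) m′)
    (inherit {R = λ x y → a + l + m ≤ y → y ≤ x}
      (λ i<j y<x x≤ _ → (λ c≤y → <⇒≤ (<-≤-trans y<x (x≤ (≤-trans c≤y (<⇒≤ y<x))))) ,
                        (λ c≤x → <⇒≤ (≤-<-trans (x≤ c≤x) i<j)))
      Rot-high (<-trans (+-monoʳ-< a′ (n<1+n m′)) a+m<n) last-left
      (s≤s⁻¹ (subst (a + l + m <_) (+-suc (a′ + suc l′) m′) c<c′))))

-- Rotations as bigrassmannian permutations

module _ (a l m : ℕ) (a+l+m≤n : a + l + m ≤ n) where

  rot<n : ∀ {x} → x < n → rot a l m x < n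
  rot<n {x} x<n with rot a l m x | rot-Rot a l m x
  ... | _ | before _ refl       = x<n
  ... | _ | left k k<m _ refl   = <-≤-trans (+-monoʳ-< (a + l) k<m) a+l+m≤n
  ... | _ | right k k<l _ refl  =
    <-≤-trans (+-monoʳ-< a k<l) (≤-trans (m≤m+n (a + l) m) a+l+m≤n)
  ... | _ | after _ refl        = x<n

  rotFin : Fin n → Fin n
  rotFin i = fromℕ< (rot<n (Fin.toℕ<n i))

  toℕ-rotFin : ∀ i → toℕ (rotFin i) ≡ rot a l m (toℕ i)
  toℕ-rotFin i = Fin.toℕ-fromℕ< _

rotFin-inverse : ∀ a l m (p : a + l + m ≤ n) (q : a + m + l ≤ n) →
                 ∀ i → rotFin a l m p (rotFin a m l q i) ≡ i
rotFin-inverse a l m p q i = Fin.toℕ-injective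
  (trans (toℕ-rotFin a l m p (rotFin a m l q i))
    (trans (cong (rot a l m) (toℕ-rotFin a m l q i)) (rot-rot a m l (toℕ i))))

rotation : ∀ a l m → a + l + m ≤ n → Permutation′ n
rotation {n} a l m p =
  permutation (rotFin a l m p) (rotFin a m l q)
    (rotFin-inverse a l m p q) (rotFin-inverse a m l q p)
  where
  q : a + m + l ≤ n
  q = subst (_≤ n) (+-swapʳ a l m) p

rotation-represents : ∀ a l m (p : a + l + m ≤ n) →
                      Represents (rotation a l m p) (rot a l m)
rotation-represents a l m p = represents (toℕ-rotFin a l m p)

-- Entries increase inside every block and across every boundary except the one from the left to the
-- right block. The left block has length `suc m`, hence last position `a + m`.
descent-position : ∀ {a l m x v w} → Rot a l (suc m) x v → Rot a l (suc m) (suc x) w →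
                   w < v → x ≡ a + m
descent-position (before x<a refl) (before _ refl) w<v =
  contradiction w<v (<-asym (n<1+n _))
descent-position {a} {l} (before x<a refl) (left k _ _ refl) w<v =
  contradiction (subst (_< a) (+-assoc a l k) (<-trans w<v x<a)) (m+n≮m a (l + k))
descent-position {a} (before x<a refl) (right k _ _ refl) w<v =
  contradiction (<-trans w<v x<a) (m+n≮m a k)
descent-position (before x<a refl) (after _ refl) w<v =
  contradiction w<v (<-asym (n<1+n _))
descent-position {a} (left k _ refl _) (before x<a _) _ =
  contradiction (<-trans (n<1+n _) x<a) (m+n≮m a k)
descent-position {a} {l} (left k _ refl refl) (left k′ _ x≡ refl) w<v
  with +-cancelˡ-≡ a (suc k) k′ (trans (+-suc a k) x≡)
... | refl = contradiction (+-cancelˡ-< (a + l) (suc k) k w<v) (<-asym (n<1+n k))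
descent-position {a} {l} {m} (left k k<m refl refl) (right k′ _ x≡ refl) _ =
  cong (a +_) (≤-antisym (s≤s⁻¹ k<m) (subst (m ≤_) (sym k≡) (m≤m+n m k′)))
  where
  k≡ : k ≡ m + k′
  k≡ = suc-injective (+-cancelˡ-≡ a (suc k) (suc m + k′)
         (trans (+-suc a k) (trans x≡ (+-assoc a (suc m) k′))))
descent-position {a} {l} {m} (left k k<m _ refl) (after ≤x refl) w<v =
  contradiction (<-trans (+-cancelˡ-< (a + l) (suc m) k (≤-<-trans ≤x w<v)) k<m) (<-irrefl refl)
descent-position {a} {m = m} (right k _ refl _) (before x<a _) _ =
  contradiction (subst (_< a) (+-assoc a (suc m) k) (<-trans (n<1+n _) x<a))
    (m+n≮m a (suc m + k))
descent-position {a} {m = m} (right k _ refl _) (left k′ k′<m x≡ _) _ =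
  contradiction (subst (_< a + suc m) (sym x≡) (+-monoʳ-< a k′<m))
    (m+n≮m (a + suc m) k ∘ <-trans (n<1+n _))
descent-position {a} {m = m} (right k _ refl refl) (right k′ _ x≡ refl) w<v
  with +-cancelˡ-≡ (a + suc m) (suc k) k′ (trans (+-suc (a + suc m) k) x≡)
... | refl = contradiction (+-cancelˡ-< a (suc k) k w<v) (<-asym (n<1+n k))
descent-position {a} {m = m} (right k _ refl refl) (after _ refl) w<v =
  contradiction (<-≤-trans (<-trans (n<1+n _) w<v) (+-monoˡ-≤ k (m≤m+n a (suc m)))) (<-irrefl refl)
descent-position {a} {l} {m} (after ≤x _) (before x<a _) _ = contradiction
  (≤-<-trans ≤x (<-trans (n<1+n _) x<a))
  (m+n≮m a (l + suc m) ∘ subst (_< a) (+-assoc a l (suc m)))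
descent-position {a} {l} (after _ refl) (left k _ x≡ refl) w<v =
  contradiction (≤-<-trans (+-monoˡ-≤ k (m≤m+n a l)) (<-trans w<v (n<1+n _)))
    (<-irrefl (sym x≡))
descent-position {a} {l} {m} (after ≤x _) (right k k<l x≡ _) _ =
  contradiction (≤-<-trans ≤x (<-trans (n<1+n _) (≤-<-trans (≤-reflexive x≡)
    (subst (a + suc m + k <_) (+-swapʳ a (suc m) l) (+-monoʳ-< (a + suc m) k<l)))))
    (<-irrefl refl)
descent-position (after _ refl) (after _ refl) w<v =
  contradiction w<v (<-asym (n<1+n _))

rot-one-descent : ∀ {ω : Permutation′ n} {a l m} → a + suc l + suc m ≤ n →
  Represents ω (rot a (suc l) (suc m)) → HasExactlyOneDescent ω
rot-one-descent {n} {ω} {a} {l} {m} ≤n h =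
  fromℕ< p<n ,
  (fromℕ< q<n ,
   trans (Fin.toℕ-fromℕ< q<n) (trans (+-suc a m) (cong suc (sym (Fin.toℕ-fromℕ< p<n)))) ,
   subst₂ _<_ (sym (at q<n (right 0 z<s (sym (+-identityʳ _)) (sym (+-identityʳ a)))))
              (sym (at p<n (left m ≤-refl refl refl)))
              (<-≤-trans (m<m+n a z<s) (m≤m+n (a + suc l) m))) ,
  unique
  where
  q<n : a + suc m < n
  q<n = <-≤-trans (+-monoˡ-< (suc m) (m<m+n a z<s)) ≤n
  p<n : a + m < n
  p<n = <-trans (+-monoʳ-< a (n<1+n m)) q<n
  at : ∀ {x y} (x<n : x < n) → Rot a (suc l) (suc m) x y → toℕ (ω ⟨$⟩ʳ fromℕ< x<n) ≡ y
  at x<n xy = trans (value h _)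
    (trans (cong (rot a (suc l) (suc m)) (Fin.toℕ-fromℕ< x<n)) (Rot⇒rot xy))
  graph : ∀ i → Rot a (suc l) (suc m) (toℕ i) (toℕ (ω ⟨$⟩ʳ i))
  graph i = subst (Rot a (suc l) (suc m) (toℕ i)) (sym (value h i))
    (rot-Rot a (suc l) (suc m) (toℕ i))
  unique : ∀ {i} → IsDescent ω i → fromℕ< p<n ≡ i
  unique {i} (j , j≡ , ωj<ωi) = Fin.toℕ-injective (trans (Fin.toℕ-fromℕ< p<n)
    (sym (descent-position (graph i)
      (subst (λ x → Rot a (suc l) (suc m) x (toℕ (ω ⟨$⟩ʳ j))) j≡ (graph j)) ωj<ωi)))

rotation𝔅 : ∀ a l m → a + suc l + suc m ≤ n → 𝔅 n
rotation𝔅 {n} a l m p = record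
  { perm               = ω
  ; one-descent        = rot-one-descent p h
  ; one-descent-of-inv = rot-one-descent (subst (_≤ n) (+-swapʳ a (suc l) (suc m)) p)
                           (Represents-flip {ω = ω} h)
  }
  where
  ω : Permutation′ n
  ω = rotation a (suc l) (suc m) p
  h : Represents ω (rot a (suc l) (suc m))
  h = rotation-represents a (suc l) (suc m) p

-- Length vectors and the Bruhat order on 𝔅

module BlockRot {ω : Permutation′ n} (A : BlockForm ω) where
  open BlockForm A

  a+ℓ₂≡b : a + (b ∸ a) ≡ b
  a+ℓ₂≡b = m+[n∸m]≡n (<⇒≤ a<b)

  a+ℓ₂+ℓ₃≡c : a + (b ∸ a) + (c ∸ b) ≡ c
  a+ℓ₂+ℓ₃≡c = trans (cong (_+ (c ∸ b)) a+ℓ₂≡b) (m+[n∸m]≡n (<⇒≤ b<c))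

  block-represents : Represents ω (rot a (b ∸ a) (c ∸ b))
  block-represents = represents λ i → entry i (rot-Rot a (b ∸ a) (c ∸ b) (toℕ i))
    where
    entry : ∀ i {y} → Rot a (b ∸ a) (c ∸ b) (toℕ i) y → toℕ (ω ⟨$⟩ʳ i) ≡ y
    entry i (before x<a refl)    = block₁ i x<a
    entry i (left k k< x≡ refl)  = trans (block₂ i k k< x≡) (cong (_+ k) (sym a+ℓ₂≡b))
    entry i (right k k< x≡ refl) = block₃ i k k< x≡
    entry i (after ≤x refl)      = block₄ i (subst (_≤ toℕ i) a+ℓ₂+ℓ₃≡c ≤x)

ℕ⁴ : Set
ℕ⁴ = ℕ × ℕ × ℕ × ℕ

total : ℕ⁴ → ℕ
total (s₁ , s₂ , s₃ , s₄) = s₁ + s₂ + s₃ + s₄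

infix 4 _⊑_

_⊑_ : ℕ⁴ → ℕ⁴ → Set
(s₁ , s₂ , s₃ , s₄) ⊑ (t₁ , t₂ , t₃ , t₄) = s₁ ≥ t₁ × s₂ ≤ t₂ × s₃ ≤ t₃ × s₄ ≥ t₄

⊑-antisym : ∀ {s t} → s ⊑ t → t ⊑ s → s ≡ t
⊑-antisym (p₁ , p₂ , p₃ , p₄) (q₁ , q₂ , q₃ , q₄) =
  cong₂ _,_ (≤-antisym q₁ p₁) (cong₂ _,_ (≤-antisym p₂ q₂)
    (cong₂ _,_ (≤-antisym p₃ q₃) (≤-antisym q₄ p₄)))

lengths : 𝔅 n → ℕ⁴
lengths σ = ℓ₁ σ , ℓ₂ σ , ℓ₃ σ , ℓ₄ σ

-- ℓ₁, ℓ₂ and ℓ₃ enter through their predecessors, so their positivity is built in.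
record Shape (ω : Permutation′ n) (s : ℕ⁴) : Set where
  constructor shape
  field
    {a l m}     : ℕ
    a+l+m≤n     : a + suc l + suc m ≤ n
    represented : Represents ω (rot a (suc l) (suc m))
    vector      : s ≡ (suc a , suc l , suc m , n + 1 ∸ (a + suc l + suc m))

0<⇒suc : ∀ {x} → 0 < x → ∃ λ y → x ≡ suc y
0<⇒suc {suc y} _ = y , refl

𝔅-shape : (σ : 𝔅 n) → Shape (perm σ) (lengths σ)
𝔅-shape {n} σ = go (0<⇒suc (m<n⇒0<n∸m a<b)) (0<⇒suc (m<n⇒0<n∸m b<c)) a+ℓ₂+ℓ₃≡c block-represents
  where
  open BlockForm (blockForm σ)
  open BlockRot (blockForm σ)
  -- The lengths `b ∸ a` and `c ∸ b` are generalised to variables so that their equations with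
  -- successors can be matched.
  go : ∀ {l m} → (∃ λ l′ → l ≡ suc l′) → (∃ λ m′ → m ≡ suc m′) → a + l + m ≡ c →
       Represents (perm σ) (rot a l m) → Shape (perm σ) (a + 1 , l , m , n + 1 ∸ c)
  go (l′ , refl) (m′ , refl) eq h = shape (subst (_≤ n) (sym eq) c≤n) h
    (cong₂ _,_ (+-comm a 1) (cong (λ x → suc l′ , suc m′ , n + 1 ∸ x) (sym eq)))

Shape-total : ∀ {ω : Permutation′ n} {s} → Shape ω s → total s ≡ n + 2
Shape-total {n} (shape {a} {l} {m} ≤n _ refl) = begin
  suc c + (n + 1 ∸ c)   ≡⟨ cong suc (m+[n∸m]≡n (≤-trans ≤n (m≤m+n n 1))) ⟩
  suc (n + 1)           ≡⟨ +-suc n 1 ⟨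
  n + 2                 ∎
  where
  open ≡-Reasoning
  c : ℕ
  c = a + suc l + suc m

≤ᴮ⇒⊑ : ∀ {σ τ : Permutation′ n} {s t} → Shape σ s → Shape τ t → σ ≤ᴮ τ → s ⊑ t
≤ᴮ⇒⊑ {n} {σ} {τ} (shape p h refl) (shape q k refl) σ≤τ =
  s≤s (≤ᴮ⇒a≥ {σ = σ} {τ} σ≤τ k h p) , ≤ᴮ⇒l≤ {σ = σ} {τ} σ≤τ k h p ,
  ≤ᴮ⇒m≤ {σ = σ} {τ} σ≤τ k h p , ∸-monoʳ-≤ (n + 1) (≤ᴮ⇒sum≤ {σ = σ} {τ} σ≤τ k h p)

⊑⇒≤ᴮ : ∀ {σ τ : Permutation′ n} {s t} → Shape σ s → Shape τ t → s ⊑ t → σ ≤ᴮ τ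
⊑⇒≤ᴮ {n} {σ} {τ} (shape {a} {l} {m} p h refl) (shape {a′} {l′} {m′} q k refl)
  (s≤s a≥ , l≤ , m≤ , ∸≥)
  with reducesTo {ω = τ} a≥ l≤ m≤
         -- Subtraction from `n + 1` is strictly decreasing on arguments up to `n + 1`, so the
         -- inequality for ℓ₄ yields the one for the sums.
         (≮⇒≥ λ c′<c → <⇒≱ (∸-monoʳ-< c′<c (≤-trans p (m≤m+n n 1))) ∸≥) q k
... | ρ , reds , hρ = ρ , reds , represents-≈ hρ h

≈⇒≤ᴮ : {σ τ : Permutation′ n} → σ ≈ₚ τ → σ ≤ᴮ τ
≈⇒≤ᴮ {τ = τ} σ≈τ = τ , ε , sym ∘ σ≈τ

Shape-≈ : ∀ {σ τ : Permutation′ n} {s} → Shape σ s → Shape τ s → σ ≈ₚ τ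
Shape-≈ (shape _ h refl) (shape _ k refl) = represents-≈ h k

-- A permutation lies below itself, so its two vectors are related by `⊑` in both directions. The
-- triple of the block form need not be recovered.
Shape-functional : ∀ {σ : Permutation′ n} {s t} → Shape σ s → Shape σ t → s ≡ t
Shape-functional {σ = σ} S T =
  ⊑-antisym (≤ᴮ⇒⊑ S T (≈⇒≤ᴮ {σ = σ} λ _ → refl)) (≤ᴮ⇒⊑ T S (≈⇒≤ᴮ {σ = σ} λ _ → refl))

lengths-surjective : ∀ {s₁ s₂ s₃ s₄} → 0 < s₁ → 0 < s₂ → 0 < s₃ → 0 < s₄ →
  total (s₁ , s₂ , s₃ , s₄) ≡ n + 2 → ∃ λ (τ : 𝔅 n) → lengths τ ≡ (s₁ , s₂ , s₃ , s₄)
lengths-surjective {n} {suc a} {suc l} {suc m} {suc w} _ _ _ _ eq =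
  -- `lengths τ` rests on the sealed `blockForm τ` and does not compute; it is compared with the
  -- shape known by construction.
  τ , Shape-functional {σ = perm τ} (𝔅-shape τ)
        (shape c≤n (rotation-represents a (suc l) (suc m) c≤n)
          (cong (λ x → suc a , suc l , suc m , x) w≡))
  where
  c : ℕ
  c = a + suc l + suc m
  c+w : c + suc w ≡ n + 1
  c+w = suc-injective (trans eq (+-suc n 1))
  c≤n : c ≤ n
  c≤n = subst (c ≤_) (suc-injective (trans (sym (+-suc c w)) (trans c+w (+-comm n 1))))
          (m≤m+n c w)
  w≡ : suc w ≡ n + 1 ∸ c
  w≡ = sym (trans (cong (_∸ c) (sym c+w)) (m+n∸m≡n c (suc w)))
  τ : 𝔅 n
  τ = rotation𝔅 a l m c≤n

Shape-positive : ∀ {ω : Permutation′ n} {s₁ s₂ s₃ s₄} → Shape ω (s₁ , s₂ , s₃ , s₄) →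
  0 < s₁ × 0 < s₂ × 0 < s₃ × 0 < s₄
Shape-positive {n} (shape {a} {l} {m} ≤n _ refl) =
  z<s , z<s , z<s , m<n⇒0<n∸m (≤-<-trans ≤n (m<m+n n z<s))

-- Bounds of a family

maximum≤⇔ : ∀ {r} (f : Fin (suc r) → ℕ) x → maximum f ≤ x ⇔ (∀ j → f j ≤ x)
maximum≤⇔ f x = mk⇔ (to f) (from f)
  where
  to : ∀ {r} (f : Fin (suc r) → ℕ) → maximum f ≤ x → ∀ j → f j ≤ x
  to {zero}  f le Fin.zero    = le
  to {suc r} f le Fin.zero    = m⊔n≤o⇒m≤o _ _ le
  to {suc r} f le (Fin.suc j) = to (f ∘ Fin.suc) (m⊔n≤o⇒n≤o _ _ le) j
  from : ∀ {r} (f : Fin (suc r) → ℕ) → (∀ j → f j ≤ x) → maximum f ≤ x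
  from {zero}  f h = h Fin.zero
  from {suc r} f h = ⊔-lub (h Fin.zero) (from (f ∘ Fin.suc) (h ∘ Fin.suc))

≤minimum⇔ : ∀ {r} (f : Fin (suc r) → ℕ) x → x ≤ minimum f ⇔ (∀ j → x ≤ f j)
≤minimum⇔ f x = mk⇔ (to f) (from f)
  where
  to : ∀ {r} (f : Fin (suc r) → ℕ) → x ≤ minimum f → ∀ j → x ≤ f j
  to {zero}  f le Fin.zero    = le
  to {suc r} f le Fin.zero    = m≤n⊓o⇒m≤n _ _ le
  to {suc r} f le (Fin.suc j) = to (f ∘ Fin.suc) (m≤n⊓o⇒m≤o _ _ le) j
  from : ∀ {r} (f : Fin (suc r) → ℕ) → (∀ j → x ≤ f j) → x ≤ minimum f
  from {zero}  f h = h Fin.zero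
  from {suc r} f h = ⊓-glb (h Fin.zero) (from (f ∘ Fin.suc) (h ∘ Fin.suc))

module _ (π : Fin (suc r) → 𝔅 n) where

  -- In general this is not a length vector, since its total can differ from `n + 2`.
  bound : ℕ⁴
  bound = maximum (ℓ₁ ∘ π) , minimum (ℓ₂ ∘ π) , minimum (ℓ₃ ∘ π) , maximum (ℓ₄ ∘ π)

  ⊑bound⇔ : ∀ s → s ⊑ bound ⇔ (∀ j → s ⊑ lengths (π j))
  ⊑bound⇔ (s₁ , s₂ , s₃ , s₄) = mk⇔
    (λ (p₁ , p₂ , p₃ , p₄) j → to M₁ p₁ j , to M₂ p₂ j , to M₃ p₃ j , to M₄ p₄ j)
    (λ h → from M₁ (proj₁ ∘ h) , from M₂ (proj₁ ∘ proj₂ ∘ h) ,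
           from M₃ (proj₁ ∘ proj₂ ∘ proj₂ ∘ h) , from M₄ (proj₂ ∘ proj₂ ∘ proj₂ ∘ h))
    where
    open Equivalence
    M₁ = maximum≤⇔ (ℓ₁ ∘ π) s₁
    M₂ = ≤minimum⇔ (ℓ₂ ∘ π) s₂
    M₃ = ≤minimum⇔ (ℓ₃ ∘ π) s₃
    M₄ = maximum≤⇔ (ℓ₄ ∘ π) s₄

  below⇔ : ∀ τ → (∀ j → perm τ ≤ᴮ perm (π j)) ⇔ lengths τ ⊑ bound
  below⇔ τ = mk⇔
    (λ h → Equivalence.from (⊑bound⇔ (lengths τ))
             (λ j → ≤ᴮ⇒⊑ (𝔅-shape τ) (𝔅-shape (π j)) (h j)))
    (λ h j → ⊑⇒≤ᴮ (𝔅-shape τ) (𝔅-shape (π j))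
               (Equivalence.to (⊑bound⇔ (lengths τ)) h j))

-- Maximal vectors below a bound

Tight : ℕ⁴ → ℕ⁴ → Set
Tight (s₁ , s₂ , s₃ , s₄) (b₁ , b₂ , b₃ , b₄) = (s₂ ≡ b₂ × s₃ ≡ b₃) ⊎ (s₁ ≡ b₁ × s₄ ≡ b₄)

IsMaximalVector : ℕ⁴ → ℕ⁴ → Set
IsMaximalVector b s = ∀ t → total t ≡ total s → t ⊑ b → s ⊑ t → t ≡ s

+-squeeze : ∀ {x y u v} → x ≤ y → u ≤ v → x + u ≡ y + v → x ≡ y × u ≡ v
+-squeeze {x} {y} {u} {v} x≤y u≤v eq with m≤n⇒m<n∨m≡n x≤y
... | inj₁ x<y  = contradiction eq (<⇒≢ (+-mono-<-≤ x<y u≤v))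
... | inj₂ refl = refl , +-cancelˡ-≡ x u v eq

-- The two tight coordinates of `t` are squeezed between those of `s` and `b`. The other two then
-- have the same sum in `s` and `t` and move in the same direction, so they agree as well.
tight⇒maximal : ∀ s b → Tight s b → IsMaximalVector b s
tight⇒maximal (s₁ , _ , _ , s₄) (_ , b₂ , b₃ , _) (inj₁ (refl , refl))
  (t₁ , t₂ , t₃ , t₄) eq (_ , t₂≤ , t₃≤ , _) (t₁≤ , ≤t₂ , ≤t₃ , t₄≤)
  with ≤-antisym t₂≤ ≤t₂ | ≤-antisym t₃≤ ≤t₃
... | refl | refl
  with +-squeeze t₁≤ t₄≤ (+-cancelʳ-≡ (t₂ + t₃) _ _
         (trans (outer t₁ t₂ t₃ t₄) (trans eq (sym (outer s₁ t₂ t₃ s₄)))))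
  where
  outer : ∀ x y z w → x + w + (y + z) ≡ x + y + z + w
  outer = solve-∀
... | refl , refl = refl
tight⇒maximal (_ , s₂ , s₃ , _) (b₁ , _ , _ , b₄) (inj₂ (refl , refl))
  (t₁ , t₂ , t₃ , t₄) eq (≤t₁ , _ , _ , ≤t₄) (t₁≤ , ≤t₂ , ≤t₃ , t₄≤)
  with ≤-antisym t₁≤ ≤t₁ | ≤-antisym t₄≤ ≤t₄
... | refl | refl
  with +-squeeze ≤t₂ ≤t₃ (+-cancelˡ-≡ (t₁ + t₄) _ _
         (trans (inner t₁ s₂ s₃ t₄) (trans (sym eq) (sym (inner t₁ t₂ t₃ t₄)))))
  where
  inner : ∀ x y z w → x + w + (y + z) ≡ x + y + z + w
  inner = solve-∀
... | refl , refl = refl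

-- If one of ℓ₁, ℓ₄ and one of ℓ₂, ℓ₃ are slack, then moving a unit from the
-- former to the latter gives a larger vector.
maximal⇒tight : ∀ s b → s ⊑ b → IsMaximalVector b s → Tight s b
maximal⇒tight (s₁ , s₂ , s₃ , s₄) b (p₁ , p₂ , p₃ , p₄) max
  with m≤n⇒m<n∨m≡n p₁ | m≤n⇒m<n∨m≡n p₂ | m≤n⇒m<n∨m≡n p₃ | m≤n⇒m<n∨m≡n p₄
... | _         | inj₂ e₂   | inj₂ e₃   | _         = inj₁ (e₂ , e₃)
... | inj₂ e₁   | _         | _         | inj₂ e₄   = inj₂ (sym e₁ , sym e₄)
... | inj₁ (s≤s {n = x} q₁) | inj₁ q₂ | _ | _ =
  contradiction (cong proj₁ (max (x , suc s₂ , s₃ , s₄)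
    (cong (λ y → y + s₃ + s₄) (+-suc x s₂))
    (q₁ , q₂ , p₃ , p₄) (n≤1+n x , n≤1+n s₂ , ≤-refl , ≤-refl))) (<⇒≢ (n<1+n x))
... | inj₁ (s≤s {n = x} q₁) | _ | inj₁ q₃ | _ =
  contradiction (cong proj₁ (max (x , s₂ , suc s₃ , s₄)
    (cong (_+ s₄) (+-suc (x + s₂) s₃))
    (q₁ , p₂ , q₃ , p₄) (n≤1+n x , ≤-refl , n≤1+n s₃ , ≤-refl))) (<⇒≢ (n<1+n x))
... | _ | inj₁ q₂ | _ | inj₁ (s≤s {n = x} q₄) =
  contradiction (cong (proj₁ ∘ proj₂) (max (s₁ , suc s₂ , s₃ , x)
    (trans (cong (λ y → y + s₃ + x) (+-suc s₁ s₂)) (sym (+-suc (s₁ + s₂ + s₃) x)))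
    (p₁ , q₂ , p₃ , q₄) (≤-refl , n≤1+n s₂ , ≤-refl , n≤1+n x))) (>⇒≢ (n<1+n s₂))
... | _ | _ | inj₁ q₃ | inj₁ (s≤s {n = x} q₄) =
  contradiction (cong (proj₁ ∘ proj₂ ∘ proj₂) (max (s₁ , s₂ , suc s₃ , x)
    (trans (cong (_+ x) (+-suc (s₁ + s₂) s₃)) (sym (+-suc (s₁ + s₂ + s₃) x)))
    (p₁ , p₂ , q₃ , q₄) (≤-refl , ≤-refl , n≤1+n s₃ , n≤1+n x))) (>⇒≢ (n<1+n s₃))

-- From vectors back to permutations

lengths-total : (σ τ : 𝔅 n) → total (lengths σ) ≡ total (lengths τ)
lengths-total σ τ = trans (Shape-total (𝔅-shape σ)) (sym (Shape-total (𝔅-shape τ)))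

lengths-injective : (σ τ : 𝔅 n) → lengths σ ≡ lengths τ → perm σ ≈ₚ perm τ
lengths-injective σ τ eq = Shape-≈ (subst (Shape (perm σ)) eq (𝔅-shape σ)) (𝔅-shape τ)

module _ (π : Fin (suc r) → 𝔅 n) (σ : 𝔅 n) where

  maximalVector⇒maximal : lengths σ ⊑ bound π → IsMaximalVector (bound π) (lengths σ) →
                          IsMaximalBelow π σ
  maximalVector⇒maximal σ⊑ max =
    Equivalence.from (below⇔ π σ) σ⊑ ,
    λ τ τ≤ σ≤τ → lengths-injective τ σ (max (lengths τ) (lengths-total τ σ)
      (Equivalence.to (below⇔ π τ) τ≤) (≤ᴮ⇒⊑ (𝔅-shape σ) (𝔅-shape τ) σ≤τ))

  maximal⇒maximalVector : IsMaximalBelow π σ → IsMaximalVector (bound π) (lengths σ)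
  maximal⇒maximalVector (_ , max) t@(t₁ , t₂ , t₃ , t₄) eq t⊑ σ⊑t@(_ , ≤t₂ , ≤t₃ , _)
    -- `t` is positive: its outer coordinates are at least those of the first member of the family,
    -- and its inner ones at least those of `σ`. Hence it is the length vector of some `τ`.
    with Equivalence.to (⊑bound⇔ π t) t⊑ Fin.zero
       | Shape-positive (𝔅-shape (π Fin.zero)) | Shape-positive (𝔅-shape σ)
  ... | t₁≥ , _ , _ , t₄≥ | 0<π₁ , _ , _ , 0<π₄ | _ , 0<σ₂ , 0<σ₃ , _
    with lengths-surjective {n} (<-≤-trans 0<π₁ t₁≥) (<-≤-trans 0<σ₂ ≤t₂)
           (<-≤-trans 0<σ₃ ≤t₃) (<-≤-trans 0<π₄ t₄≥)
           (trans eq (Shape-total (𝔅-shape σ)))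
  ... | τ , refl = ⊑-antisym
    (≤ᴮ⇒⊑ (𝔅-shape τ) (𝔅-shape σ) (≈⇒≤ᴮ {σ = perm τ} (max τ
      (Equivalence.from (below⇔ π τ) t⊑)
      (⊑⇒≤ᴮ (𝔅-shape σ) (𝔅-shape τ) σ⊑t))))
    σ⊑t

theorem3p8 : (n r : ℕ) .{{_ : NonZero n}} .{{_ : NonZero r}} →
    (π : Fin r → 𝔅 n) (σ : 𝔅 n) →
    IsMaximalBelow π σ ⇔
    ((ℓ₁ σ ≥ maximum (ℓ₁ ∘ π) ×
    ℓ₂ σ ≤ minimum (ℓ₂ ∘ π) ×
    ℓ₃ σ ≤ minimum (ℓ₃ ∘ π) ×
    ℓ₄ σ ≥ maximum (ℓ₄ ∘ π)) ×
    ((ℓ₂ σ ≡ minimum (ℓ₂ ∘ π) × ℓ₃ σ ≡ minimum (ℓ₃ ∘ π)) ⊎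
    (ℓ₁ σ ≡ maximum (ℓ₁ ∘ π) × ℓ₄ σ ≡ maximum (ℓ₄ ∘ π))))
theorem3p8 n (suc r) π σ = mk⇔
  (λ h → let σ⊑ = Equivalence.to (below⇔ π σ) (proj₁ h) in
         σ⊑ , maximal⇒tight (lengths σ) (bound π) σ⊑ (maximal⇒maximalVector π σ h))
  (λ (σ⊑ , tight) → maximalVector⇒maximal π σ σ⊑
                      (tight⇒maximal (lengths σ) (bound π) tight))
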